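{- Let $p$ be a prime, $n\ge1$, and let $k<l$ be positive integers. Then in the ring $\tilde R$ described in the context, $\tilde T(p^k)\tilde T(p^l)\ne\tilde T(p^l)\tilde T(p^k)$.
   Context: Let $J=\begin{pmatrix}0&E_n\\-E_n&0\end{pmatrix}$, $G=GSp_{2n}(\mathbb Q_p)=\{g: {}^tgJg=\mu(g)J\}$, $\Delta=G\cap M_{2n}(\mathbb Z_p)$, $\Gamma=G\cap GL_{2n}(\mathbb Z_p)$, $\mathcal M=\mathbb Z_p^{2n}$ (columns). $\tilde\Delta=\Delta\times\mathcal M$ is the monoid with $(A,\mathbf a)(B,\mathbf b)=(AB,A\mathbf b+\mu(B)\mathbf a)$ and $\tilde\Gamma=\Gamma\times\mathcal M$. $\tilde R$ is the Hecke ring of $(\tilde\Gamma,\tilde\Delta)$: the free abelian group on $\tilde\Gamma\backslash\tilde\Delta/\tilde\Gamma$ with product $(\tilde\Gamma\alpha\tilde\Gamma)(\tilde\Gamma\beta\tilde\Gamma)=\sum m_\gamma\,\tilde\Gamma\gamma\tilde\Gamma$, $m_\gamma=\#\{\tilde\Gamma\delta\in\tilde\Gamma\backslash\tilde\Gamma\beta\tilde\Gamma:\gamma\delta^{ -1}\in\tilde\Gamma\alpha\tilde\Gamma\}$. $\tilde T(p^k)$ is the sum of all double cosets $\tilde\Gamma(C,\mathbf c)\tilde\Gamma$ with $v_p(\mu(C))=k$. -}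

module Defs where

open import Data.Nat as ℕ using (ℕ; zero; suc)
open import Data.Integer as ℤ using (ℤ; +_; -_)
open import Data.Integer.Divisibility using (_∣_)
open import Data.Fin using (Fin; splitAt)
open import Data.Fin.Properties using (_≟_)
open import Data.Sum using (inj₁; inj₂)
open import Data.Product using (Σ; ∃; _×_; _,_)
open import Relation.Nullary using (¬_; yes; no)
open import Relation.Binary.PropositionalEquality using (_≡_)

-- p-adic integers ℤ_p, modelled as the inverse limit lim ℤ/p^m:
-- a "raw" p-adic number is a sequence of integers a : ℕ → ℤ, where a m
-- represents a residue mod p^m.  It is a genuine element of ℤ_p when it
-- is coherent (a (m+1) ≡ a m mod p^m); two coherent sequences represent
-- the same element of ℤ_p iff a m ≡ b m mod p^m for all m.
-- Ring operations are pointwise (they preserve coherence and ≈ₚ).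

module Padic (p : ℕ) where

  Seq : Set
  Seq = ℕ → ℤ

  Coh : Seq → Set
  Coh a = ∀ m → (+ (p ℕ.^ m)) ∣ (a (suc m) ℤ.- a m)

  _≈ₚ_ : Seq → Seq → Set
  a ≈ₚ b = ∀ m → (+ (p ℕ.^ m)) ∣ (a m ℤ.- b m)

  ι : ℤ → Seq
  ι z = λ _ → z

  _⊕_ : Seq → Seq → Seq
  (a ⊕ b) m = a m ℤ.+ b m

  _⊗_ : Seq → Seq → Seq
  (a ⊗ b) m = a m ℤ.* b m

  ⊖_ : Seq → Seq
  (⊖ a) m = - a m

  IsUnit : Seq → Set
  IsUnit u = Coh u × ¬ ((+ p) ∣ u 1)

  HasVal : Seq → ℕ → Set
  HasVal x k = ∃ λ u → IsUnit u × (x ≈ₚ (ι (+ (p ℕ.^ k)) ⊗ u))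

module Hecke (p : ℕ) (n : ℕ) where
  open Padic p public

  N : ℕ
  N = n ℕ.+ n

  Mat : Set
  Mat = Fin N → Fin N → Seq

  Col : Set
  Col = Fin N → Seq

  ΣF : ∀ {m} → (Fin m → Seq) → Seq
  ΣF {zero} f = ι (+ 0)
  ΣF {suc m} f = f Fin.zero ⊕ ΣF (λ i → f (Fin.suc i))
    where import Data.Fin as Fin

  _·_ : Mat → Mat → Mat
  (A · B) i j = ΣF (λ r → A i r ⊗ B r j)

  _▹_ : Mat → Col → Col
  (A ▹ v) i = ΣF (λ r → A i r ⊗ v r)

  _*ᶜ_ : Seq → Col → Col
  (c *ᶜ v) i = c ⊗ v i

  _⊕ᶜ_ : Col → Col → Col
  (v ⊕ᶜ w) i = v i ⊕ w i

  _*ᴹ_ : Seq → Mat → Mat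
  (c *ᴹ A) i j = c ⊗ A i j

  tr : Mat → Mat
  tr A i j = A j i

  J : Mat
  J i j with splitAt n i | splitAt n j
  ... | inj₁ a | inj₂ b with a ≟ b
  ...   | yes _ = ι (+ 1)
  ...   | no  _ = ι (+ 0)
  J i j | inj₂ a | inj₁ b with a ≟ b
  ...   | yes _ = ι (- (+ 1))
  ...   | no  _ = ι (+ 0)
  J i j | _ | _ = ι (+ 0)

  _≈ᴹ_ : Mat → Mat → Set
  A ≈ᴹ B = ∀ i j → A i j ≈ₚ B i j

  _≈ᶜ_ : Col → Col → Set
  v ≈ᶜ w = ∀ i → v i ≈ₚ w i

  -- an element (A , a) of Δ̃ together with its multiplier μ(A)
  record Elt : Set where
    constructor ⟨_,_,_⟩
    field
      mat : Mat
      vec : Col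
      mult : Seq
  open Elt public

  _∘̃_ : Elt → Elt → Elt
  x ∘̃ y = ⟨ mat x · mat y , (mat x ▹ vec y) ⊕ᶜ (mult y *ᶜ vec x) , mult x ⊗ mult y ⟩

  _≈ᴱ_ : Elt → Elt → Set
  x ≈ᴱ y = (mat x ≈ᴹ mat y) × (vec x ≈ᶜ vec y) × (mult x ≈ₚ mult y)

  -- x = (A , a) ∈ Δ̃ with μ(A) = mult x and v_p(μ(A)) = k :
  -- entries of A and a in ℤ_p, ᵗA J A = μ J (μ ≠ 0 since it has a valuation,
  -- so A ∈ GSp_{2n}(ℚ_p)).
  Δ̃ : ℕ → Elt → Set
  Δ̃ k x = (∀ i j → Coh (mat x i j)) × (∀ i → Coh (vec x i))
        × Coh (mult x)
        × ((tr (mat x) · (J · mat x)) ≈ᴹ (mult x *ᴹ J))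
        × HasVal (mult x) k

  Γ̃ : Elt → Set
  Γ̃ = Δ̃ 0

  SameCoset : Elt → Elt → Set
  SameCoset x y = ∃ λ u → Γ̃ u × ((u ∘̃ x) ≈ᴱ y)

  -- the set of δ counted by the coefficient of Γ̃γΓ̃ in T̃(p^k) T̃(p^l):
  -- δ ranges over Γ̃\(⋃_{v(μ)=l} Γ̃βΓ̃) with γδ⁻¹ ∈ ⋃_{v(μ)=k} Γ̃αΓ̃.
  Mset : ℕ → ℕ → Elt → Elt → Set
  Mset k l γ δ = Δ̃ l δ × (∃ λ α → Δ̃ k α × ((α ∘̃ δ) ≈ᴱ γ))

  HasCount : (Elt → Set) → ℕ → Set
  HasCount S m = Σ (Fin m → Elt) λ r →
      (∀ i → S (r i))
    × (∀ i j → SameCoset (r i) (r j) → i ≡ j)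
    × (∀ δ → S δ → ∃ λ i → SameCoset (r i) δ)

  CoeffTT : ℕ → ℕ → Elt → ℕ → Set
  CoeffTT k l γ m = HasCount (Mset k l γ) m

{-# OPTIONS --safe #-}
module Submission where

open import Defs
open import Algebra.Properties.CommutativeSemigroup using (interchange)
open import Data.Nat as ℕ using (ℕ; zero; suc; _≤_; _<_)
import Data.Nat.Properties as ℕ
import Data.Nat.Divisibility as ℕ
open import Data.Nat.Primality using (Prime; euclidsLemma; prime⇒nonZero; prime⇒nonTrivial)
open import Data.Integer as ℤ using (ℤ; +_; -_; _+_; _*_; _-_; ∣_∣)
import Data.Integer.Properties as ℤ
import Data.Integer.Divisibility as Unsigned
open import Data.Integer.Divisibility.Signed
open import Data.Integer.DivMod using (_%ℕ_; _/ℕ_; n%ℕd<d; a≡a%ℕn+[a/ℕn]*n)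
open import Data.Integer.Tactic.RingSolver using (solve-∀)
open import Data.Fin using (Fin; zero; suc; toℕ; fromℕ<)
import Data.Fin as Fin
import Data.Fin.Properties as Fin
open import Data.Product using (∃; _×_; _,_; proj₁; proj₂)
open import Data.Sum as Sum⊎ using (inj₁; inj₂)
open import Data.Sum.Properties using (swap-involutive)
open import Function using (_∘_)
open import Relation.Nullary using (¬_; yes; no; contradiction)
open import Relation.Binary.PropositionalEquality hiding (J)
open import Algebra.Properties.Semiring.Sum ℤ.+-*-semiring as Sum using (sum)

-- Put a₀ = 1, a₀′ = k − 1 and (aᵢ, aᵢ′) = (0, k) for i ≥ 1, where i′ = σ i is the index dual to i,
-- and let γ = (C, c) with C = diag(pᵃ) diag(1, pˡ) and c = p^(k−1) e₀′.
-- The symplectic relation is only used in the dual form: A x = y implies ᵗA J y = μ(A) J x.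
--
-- In a factorisation (A, a)(B, b) = γ with v(μ(A)) = l and v(μ(B)) = k, duality for column 0 of B
-- shows that p^(l−1) divides row 0′ of A.  Since l > k, row 0′ of A b + μ(B) a = c then fails modulo
-- pᵏ, so the coefficient of γ in T̃(pˡ) T̃(pᵏ) vanishes.
--
-- If v(μ(A)) = k and v(μ(B)) = l instead, duality for b shows that p divides row 0 of A, and duality
-- for the columns of B then gives B = U diag(1, pˡ) with U ∈ Γ.  Hence B may be taken diagonal, and
-- the admissible b modulo pˡ are given by the digits tⱼ modulo p^aⱼ: finitely many cosets, but
-- not none.

-- Congruences of integers.

infix 4 _≋_[_]

-- A record rather than a synonym, so that `x`, `y` and `q` are recovered from the type by
-- unification, which the difference `x - y` would not allow.
record _≋_[_] (x y : ℤ) (q : ℕ) : Set where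
  constructor mk≋
  field divides-diff : + q ∣ x - y

private variable
  x x′ y y′ z : ℤ
  q q′ : ℕ

≋-reflexive : x ≡ y → x ≋ y [ q ]
≋-reflexive {x} refl = mk≋ (divides (+ 0) (ℤ.+-inverseʳ x))

≋-refl : x ≋ x [ q ]
≋-refl = ≋-reflexive refl

≋-sym : x ≋ y [ q ] → y ≋ x [ q ]
≋-sym {x} {y} (mk≋ d) = mk≋ (subst (_ ∣_) (swap-diff x y) (∣m⇒∣-m d))
  where
  swap-diff : ∀ x y → - (x - y) ≡ y - x
  swap-diff = solve-∀

≋-trans : x ≋ y [ q ] → y ≋ z [ q ] → x ≋ z [ q ]
≋-trans {x} {y} {_} {z} (mk≋ d) (mk≋ e) = mk≋ (subst (_ ∣_) (telescope x y z) (∣m∣n⇒∣m+n d e))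
  where
  telescope : ∀ x y z → (x - y) + (y - z) ≡ x - z
  telescope = solve-∀

+-cong≋ : x ≋ x′ [ q ] → y ≋ y′ [ q ] → x + y ≋ x′ + y′ [ q ]
+-cong≋ {x} {x′} {_} {y} {y′} (mk≋ d) (mk≋ e) =
  mk≋ (subst (_ ∣_) (eq x x′ y y′) (∣m∣n⇒∣m+n d e))
  where
  eq : ∀ x x′ y y′ → (x - x′) + (y - y′) ≡ (x + y) - (x′ + y′)
  eq = solve-∀

*-cong≋ : x ≋ x′ [ q ] → y ≋ y′ [ q ] → x * y ≋ x′ * y′ [ q ]
*-cong≋ {x} {x′} {_} {y} {y′} (mk≋ d) (mk≋ e) =
  mk≋ (subst (_ ∣_) (eq x x′ y y′) (∣m∣n⇒∣m+n (∣n⇒∣m*n y d) (∣n⇒∣m*n x′ e)))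
  where
  eq : ∀ x x′ y y′ → y * (x - x′) + x′ * (y - y′) ≡ x * y - x′ * y′
  eq = solve-∀

*-congˡ≋ : ∀ z → x ≋ y [ q ] → z * x ≋ z * y [ q ]
*-congˡ≋ z = *-cong≋ (≋-refl {z})

neg-cong≋ : x ≋ y [ q ] → - x ≋ - y [ q ]
neg-cong≋ {x} {y} (mk≋ d) = mk≋ (subst (_ ∣_) (eq x y) (∣m⇒∣-m d))
  where
  eq : ∀ x y → - (x - y) ≡ - x - - y
  eq = solve-∀

≋0⇒∣ : x ≋ + 0 [ q ] → + q ∣ x
≋0⇒∣ {x} (mk≋ d) = subst (_ ∣_) (ℤ.+-identityʳ x) d

∣⇒≋0 : + q ∣ x → x ≋ + 0 [ q ]
∣⇒≋0 {x = x} d = mk≋ (subst (_ ∣_) (sym (ℤ.+-identityʳ x)) d)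

-≋0⇒≋ : x - y ≋ + 0 [ q ] → x ≋ y [ q ]
-≋0⇒≋ d = mk≋ (≋0⇒∣ d)

≋⇒-≋0 : x ≋ y [ q ] → x - y ≋ + 0 [ q ]
≋⇒-≋0 (mk≋ d) = ∣⇒≋0 d

*≋0ʳ : ∀ z → x ≋ + 0 [ q ] → z * x ≋ + 0 [ q ]
*≋0ʳ z d = ≋-trans (*-congˡ≋ z d) (≋-reflexive (ℤ.*-zeroʳ z))

*≋0ˡ : ∀ z → x ≋ + 0 [ q ] → x * z ≋ + 0 [ q ]
*≋0ˡ {x} z d = ≋-trans (≋-reflexive (ℤ.*-comm x z)) (*≋0ʳ z d)

≋-weaken : q′ ℕ.∣ q → x ≋ y [ q ] → x ≋ y [ q′ ]
≋-weaken {q′} {q} q′∣q (mk≋ d) = mk≋ (∣-trans (∣ᵤ⇒∣ {+ q′} {+ q} q′∣q) d)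

≋-scale : ∀ r → x ≋ y [ q ] → + r * x ≋ + r * y [ r ℕ.* q ]
≋-scale {x} {y} {q} r (mk≋ d) = mk≋ (subst₂ _∣_ (sym (ℤ.pos-* r q)) (eq (+ r) x y) (*-monoʳ-∣ (+ r) d))
  where
  eq : ∀ r x y → r * (x - y) ≡ r * x - r * y
  eq = solve-∀

≋-unscale : ∀ r .{{_ : ℕ.NonZero r}} → + r * x ≋ + r * y [ r ℕ.* q ] → x ≋ y [ q ]
≋-unscale {x} {y} {q} (suc r) (mk≋ d) =
  mk≋ (*-cancelˡ-∣ (+ suc r) (subst₂ _∣_ (ℤ.pos-* (suc r) q) (eq (+ suc r) x y) d))
  where
  eq : ∀ r x y → r * x - r * y ≡ r * (x - y)
  eq = solve-∀

-- Finite sums and residues.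

sum-cong≋ : ∀ {m} {f g : Fin m → ℤ} → (∀ i → f i ≋ g i [ q ]) → sum f ≋ sum g [ q ]
sum-cong≋ {m = zero}  h = ≋-refl
sum-cong≋ {m = suc m} h = +-cong≋ (h zero) (sum-cong≋ (h ∘ suc))

sum-zero : ∀ {m} {f : Fin m → ℤ} → (∀ i → f i ≡ + 0) → sum f ≡ + 0
sum-zero {m} h = trans (Sum.sum-cong-≗ h) (Sum.sum-replicate-zero m)

sum-single : ∀ {m} {f : Fin m → ℤ} v → (∀ u → u ≢ v → f u ≡ + 0) → sum f ≡ f v
sum-single {suc m} {f} zero h =
  trans (cong (λ t → f zero + t) (sum-zero (λ i → h (suc i) λ ()))) (ℤ.+-identityʳ _)
sum-single {suc m} {f} (suc v) h =
  trans (cong₂ _+_ (h zero λ ()) (sum-single v (λ u u≢v → h (suc u) (u≢v ∘ Fin.suc-injective))))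
        (ℤ.+-identityˡ _)

sum≋0 : ∀ {m} {f : Fin m → ℤ} → (∀ i → f i ≋ + 0 [ q ]) → sum f ≋ + 0 [ q ]
sum≋0 {m = m} h = ≋-trans (sum-cong≋ h) (≋-reflexive (sum-zero {m} λ _ → refl))

residue : ∀ q .{{_ : ℕ.NonZero q}} → ℤ → Fin q
residue q x = fromℕ< (n%ℕd<d x q)

residue-≋ : ∀ q .{{_ : ℕ.NonZero q}} x → + toℕ (residue q x) ≋ x [ q ]
residue-≋ q x = ≋-sym (mk≋ (divides (x /ℕ q) eq))
  where
  open ≡-Reasoning
  r = x %ℕ q
  cancel : ∀ a b → a + b - a ≡ b
  cancel = solve-∀
  eq : x - + toℕ (residue q x) ≡ x /ℕ q * + q
  eq = begin
    x - + toℕ (residue q x)     ≡⟨ cong (λ t → x - + t) (Fin.toℕ-fromℕ< (n%ℕd<d x q)) ⟩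
    x - + r                     ≡⟨ cong (_- + r) (a≡a%ℕn+[a/ℕn]*n x q) ⟩
    + r + x /ℕ q * + q - + r    ≡⟨ cancel (+ r) _ ⟩
    x /ℕ q * + q                ∎

private
  multiple-< : ∀ d → d < q → q ℕ.∣ d → d ≡ 0
  multiple-< zero    _   _   = refl
  multiple-< (suc d) d<q q∣d = contradiction (ℕ.∣⇒≤ q∣d) (ℕ.<⇒≱ d<q)

  -- For ordered arguments the truncated difference is the true distance: a multiple of `q` smaller
  -- than `q`, hence 0.
  toℕ≋⇒≡-≤ : ∀ (s t : Fin q) → toℕ s ≤ toℕ t → + toℕ s ≋ + toℕ t [ q ] → s ≡ t
  toℕ≋⇒≡-≤ {q} s t s≤t (mk≋ d) = Fin.toℕ-injective (ℕ.≤-antisym s≤t (ℕ.m∸n≡0⇒m≤n diff≡0))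
    where
    diff≡0 : toℕ t ℕ.∸ toℕ s ≡ 0
    diff≡0 = multiple-< _ (ℕ.≤-<-trans (ℕ.m∸n≤m (toℕ t) (toℕ s)) (Fin.toℕ<n t))
      (subst (q ℕ.∣_) (trans (cong ∣_∣ (ℤ.m-n≡m⊖n (toℕ s) (toℕ t))) (ℤ.∣⊖∣-≤ s≤t)) (∣⇒∣ᵤ d))

toℕ≋⇒≡ : ∀ (s t : Fin q) → + toℕ s ≋ + toℕ t [ q ] → s ≡ t
toℕ≋⇒≡ s t s≋t with ℕ.≤-total (toℕ s) (toℕ t)
... | inj₁ s≤t = toℕ≋⇒≡-≤ s t s≤t s≋t
... | inj₂ t≤s = sym (toℕ≋⇒≡-≤ t s t≤s (≋-sym s≋t))

-- The pigeonhole principle and linear maps modulo q.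

injective⇒surjective : ∀ {n} (f : Fin n → Fin n) → (∀ {x y} → f x ≡ f y → x ≡ y) →
                       ∀ y → ∃ λ x → f x ≡ y
injective⇒surjective {suc n} f inj y with Fin.any? (λ x → f x Fin.≟ y)
... | yes hit = hit
-- A missed value `y` can be punched out of the codomain, which leaves an injection of `Fin (suc n)`
-- into `Fin n`.
... | no miss = contradiction (Fin.injective⇒≤ {f = squeeze} squeeze-inj) (ℕ.<⇒≱ ℕ.≤-refl)
  where
  y≢f : ∀ x → y ≢ f x
  y≢f x y≡fx = miss (x , sym y≡fx)
  squeeze : Fin (suc n) → Fin n
  squeeze x = Fin.punchOut (y≢f x)
  squeeze-inj : ∀ {x x′} → squeeze x ≡ squeeze x′ → x ≡ x′
  squeeze-inj {x} {x′} eq = inj (Fin.punchOut-injective (y≢f x) (y≢f x′) eq)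

funToFin-cong : ∀ {m n} {f g : Fin m → Fin n} → (∀ i → f i ≡ g i) → Fin.funToFin f ≡ Fin.funToFin g
funToFin-cong {zero}  h = refl
funToFin-cong {suc m} h = cong₂ Fin.combine (h zero) (funToFin-cong (h ∘ suc))

infix 9 _⟨·⟩_

_⟨·⟩_ : ∀ {m} → (Fin m → ℤ) → (Fin m → ℤ) → ℤ
v ⟨·⟩ w = sum (λ i → v i * w i)

⟨·⟩-distrib-minus : ∀ {m} (v x y : Fin m → ℤ) → v ⟨·⟩ x - v ⟨·⟩ y ≡ v ⟨·⟩ (λ j → x j - y j)
⟨·⟩-distrib-minus v x y = begin
  v ⟨·⟩ x - v ⟨·⟩ y                         ≡⟨ cong (_- v ⟨·⟩ y) (Sum.sum-cong-≗ λ j → split (v j) (x j) (y j)) ⟩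
  sum (λ j → v j * (x j - y j) + v j * y j) - v ⟨·⟩ y
                                            ≡⟨ cong (_- v ⟨·⟩ y) (Sum.∑-distrib-+ (λ j → v j * (x j - y j)) (λ j → v j * y j)) ⟩
  v ⟨·⟩ (λ j → x j - y j) + v ⟨·⟩ y - v ⟨·⟩ y
                                            ≡⟨ cancel _ (v ⟨·⟩ y) ⟩
  v ⟨·⟩ (λ j → x j - y j)                   ∎
  where
  open ≡-Reasoning
  split : ∀ v x y → v * x ≡ v * (x - y) + v * y
  split = solve-∀
  cancel : ∀ a b → a + b - b ≡ a
  cancel = solve-∀

⟨·⟩-assoc : ∀ {m n} (v : Fin m → ℤ) (M : Fin m → Fin n → ℤ) (w : Fin n → ℤ) →
            v ⟨·⟩ (λ i → M i ⟨·⟩ w) ≡ (λ r → v ⟨·⟩ (λ i → M i r)) ⟨·⟩ w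
⟨·⟩-assoc v M w = begin
  sum (λ i → v i * sum (λ r → M i r * w r))      ≡⟨ Sum.sum-cong-≗ (λ i → Sum.*-distribˡ-sum (v i) (λ r → M i r * w r)) ⟩
  sum (λ i → sum (λ r → v i * (M i r * w r)))    ≡⟨ Sum.∑-comm (λ i r → v i * (M i r * w r)) ⟩
  sum (λ r → sum (λ i → v i * (M i r * w r)))    ≡⟨ Sum.sum-cong-≗ (λ r → Sum.sum-cong-≗ λ i → ℤ.*-assoc (v i) (M i r) (w r)) ⟨
  sum (λ r → sum (λ i → v i * M i r * w r))      ≡⟨ Sum.sum-cong-≗ (λ r → Sum.*-distribʳ-sum (w r) (λ i → v i * M i r)) ⟨
  sum (λ r → sum (λ i → v i * M i r) * w r)      ∎
  where open ≡-Reasoning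

-- Used for U, of which duality provides only a left inverse.
injective⇒surjective-mod : ∀ q .{{_ : ℕ.NonZero q}} {m} (U : Fin m → Fin m → ℤ) →
  (∀ x → (∀ i → U i ⟨·⟩ x ≋ + 0 [ q ]) → ∀ j → x j ≋ + 0 [ q ]) →
  ∀ (b : Fin m → ℤ) → ∃ λ w → ∀ i → U i ⟨·⟩ w ≋ b i [ q ]
injective⇒surjective-mod q {m} U inj b = lift v , hits
  where
  lift : (Fin m → Fin q) → Fin m → ℤ
  lift v j = + toℕ (v j)
  F : (Fin m → Fin q) → Fin m → Fin q
  F v i = residue q (U i ⟨·⟩ lift v)
  F-≋ : ∀ v i → lift (F v) i ≋ U i ⟨·⟩ lift v [ q ]
  F-≋ v i = residue-≋ q (U i ⟨·⟩ lift v)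
  F-inj : ∀ v w → (∀ i → F v i ≡ F w i) → ∀ j → v j ≡ w j
  F-inj v w Fv≡Fw j = toℕ≋⇒≡ (v j) (w j) (-≋0⇒≋ (inj (λ j → lift v j - lift w j) kernel j))
    where
    kernel : ∀ i → U i ⟨·⟩ (λ j → lift v j - lift w j) ≋ + 0 [ q ]
    kernel i = ≋-trans (≋-reflexive (sym (⟨·⟩-distrib-minus (U i) (lift v) (lift w))))
      (≋⇒-≋0 (≋-trans (≋-sym (F-≋ v i)) (≋-trans (≋-reflexive (cong (λ t → + toℕ t) (Fv≡Fw i))) (F-≋ w i))))
  -- Vectors of residues are coded by single numbers, so that the pigeonhole principle for `Fin`
  -- applies to them.
  code : Fin (q ℕ.^ m) → Fin (q ℕ.^ m)
  code s = Fin.funToFin (F (Fin.finToFun s))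
  code-inj : ∀ {s t} → code s ≡ code t → s ≡ t
  code-inj {s} {t} eq = begin
    s                                                   ≡⟨ Fin.funToFin-finToFin {m} {q} s ⟨
    Fin.funToFin (Fin.finToFun {q} {m} s)               ≡⟨ funToFin-cong (F-inj (Fin.finToFun s) (Fin.finToFun t) same) ⟩
    Fin.funToFin (Fin.finToFun {q} {m} t)               ≡⟨ Fin.funToFin-finToFin {m} {q} t ⟩
    t                                                   ∎
    where
    open ≡-Reasoning
    same : ∀ i → F (Fin.finToFun s) i ≡ F (Fin.finToFun t) i
    same i = begin
      F (Fin.finToFun s) i        ≡⟨ Fin.finToFun-funToFin (F (Fin.finToFun s)) i ⟨
      Fin.finToFun (code s) i     ≡⟨ cong (λ c → Fin.finToFun c i) eq ⟩
      Fin.finToFun (code t) i     ≡⟨ Fin.finToFun-funToFin (F (Fin.finToFun t)) i ⟩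
      F (Fin.finToFun t) i        ∎
  target : Fin m → Fin q
  target i = residue q (b i)
  preimage : ∃ λ s → code s ≡ Fin.funToFin target
  preimage = injective⇒surjective code code-inj (Fin.funToFin target)
  v : Fin m → Fin q
  v = Fin.finToFun (proj₁ preimage)
  F-v : ∀ i → F v i ≡ target i
  F-v i = begin
    F v i                                       ≡⟨ Fin.finToFun-funToFin (F v) i ⟨
    Fin.finToFun (code (proj₁ preimage)) i      ≡⟨ cong (λ c → Fin.finToFun c i) (proj₂ preimage) ⟩
    Fin.finToFun (Fin.funToFin target) i        ≡⟨ Fin.finToFun-funToFin target i ⟩
    target i                                    ∎
    where open ≡-Reasoning
  hits : ∀ i → U i ⟨·⟩ lift v ≋ b i [ q ]
  hits i = ≋-trans (≋-sym (F-≋ v i)) (≋-trans (≋-reflexive (cong (λ t → + toℕ t) (F-v i))) (residue-≋ q (b i)))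

-- Enumeration of a finite product of finite sets.

record ΠFin-Enumeration {m} (s : Fin m → ℕ) : Set where
  field
    size       : ℕ
    enum       : Fin size → ∀ j → Fin (s j)
    injective  : ∀ {a b} → (∀ j → enum a j ≡ enum b j) → a ≡ b
    surjective : ∀ (t : ∀ j → Fin (s j)) → ∃ λ a → ∀ j → enum a j ≡ t j

-- Mixed radix: the choice at `zero` is the leading digit and the other choices form the remainder.
-- The empty product has its one empty choice.
enumerate-ΠFin : ∀ {m} (s : Fin m → ℕ) → ΠFin-Enumeration s
enumerate-ΠFin {zero} s = record
  { size = 1 ; enum = λ _ () ; injective = λ { {zero} {zero} _ → refl } ; surjective = λ _ → zero , λ () }
enumerate-ΠFin {suc m} s = record
  { size = s zero ℕ.* size
  ; enum = enum′
  ; injective = λ {a} {b} h → begin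
      a                                                         ≡⟨ Fin.combine-remQuot {s zero} size a ⟨
      Fin.combine (Fin.quotient {s zero} size a) (Fin.remainder {s zero} size a)
        ≡⟨ cong₂ Fin.combine (h zero) (injective (h ∘ suc)) ⟩
      Fin.combine (Fin.quotient {s zero} size b) (Fin.remainder {s zero} size b)
        ≡⟨ Fin.combine-remQuot {s zero} size b ⟩
      b                                                         ∎
  ; surjective = surjective′
  }
  where
  open ΠFin-Enumeration (enumerate-ΠFin (s ∘ suc))
  open ≡-Reasoning
  enum′ : Fin (s zero ℕ.* size) → ∀ j → Fin (s j)
  enum′ a zero    = Fin.quotient {s zero} size a
  enum′ a (suc j) = enum (Fin.remainder {s zero} size a) j
  surjective′ : ∀ (t : ∀ j → Fin (s j)) → ∃ λ a → ∀ j → enum′ a j ≡ t j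
  surjective′ t with surjective (t ∘ suc)
  ... | a , hits = Fin.combine (t zero) a , λ where
    zero    → cong proj₁ (Fin.remQuot-combine (t zero) a)
    (suc j) → trans (cong (λ r → enum (proj₂ r) j) (Fin.remQuot-combine (t zero) a)) (hits j)

-- Arithmetic of p-adic integers, one level at a time.

module PadicProperties (p : ℕ) (p-prime : Prime p) where
  open Padic p

  instance
    p-nonZero : ℕ.NonZero p
    p-nonZero = prime⇒nonZero p-prime

  p^-nonZero : ∀ m → ℕ.NonZero (p ℕ.^ m)
  p^-nonZero m = ℕ.m^n≢0 p m

  at : ∀ a b → a ≈ₚ b → ∀ m → a m ≋ b m [ p ℕ.^ m ]
  at a b a≈b m = mk≋ (∣ᵤ⇒∣ {+ (p ℕ.^ m)} {a m - b m} (a≈b m))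

  levelwise : ∀ a b → (∀ m → a m ≋ b m [ p ℕ.^ m ]) → a ≈ₚ b
  levelwise a b h m = ∣⇒∣ᵤ (_≋_[_].divides-diff (h m))

  coh-suc : ∀ a → Coh a → ∀ m → a (suc m) ≋ a m [ p ℕ.^ m ]
  coh-suc a a-coh m = mk≋ (∣ᵤ⇒∣ {+ (p ℕ.^ m)} {a (suc m) - a m} (a-coh m))

  suc-coh : ∀ a → (∀ m → a (suc m) ≋ a m [ p ℕ.^ m ]) → Coh a
  suc-coh a h m = ∣⇒∣ᵤ (_≋_[_].divides-diff (h m))

  ≋-lower : ∀ {m m′} → m ≤ m′ → x ≋ y [ p ℕ.^ m′ ] → x ≋ y [ p ℕ.^ m ]
  ≋-lower {m = m} {m′} m≤m′ = ≋-weaken (ℕ.divides (p ℕ.^ (m′ ℕ.∸ m)) (begin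
    p ℕ.^ m′                              ≡⟨ cong (p ℕ.^_) (ℕ.m∸n+n≡m m≤m′) ⟨
    p ℕ.^ (m′ ℕ.∸ m ℕ.+ m)                ≡⟨ ℕ.^-distribˡ-+-* p (m′ ℕ.∸ m) m ⟩
    p ℕ.^ (m′ ℕ.∸ m) ℕ.* p ℕ.^ m          ∎))
    where open ≡-Reasoning

  coh-+ : ∀ a → Coh a → ∀ e m → a (e ℕ.+ m) ≋ a m [ p ℕ.^ m ]
  coh-+ a a-coh zero    m = ≋-refl
  coh-+ a a-coh (suc e) m =
    ≋-trans (≋-lower (ℕ.m≤n+m m e) (coh-suc a a-coh (e ℕ.+ m))) (coh-+ a a-coh e m)

  coh-≤ : ∀ a → Coh a → ∀ {m m′} → m ≤ m′ → a m′ ≋ a m [ p ℕ.^ m ]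
  coh-≤ a a-coh {m} {m′} m≤m′ =
    subst (λ t → a t ≋ a m [ p ℕ.^ m ]) (ℕ.m∸n+n≡m m≤m′) (coh-+ a a-coh (m′ ℕ.∸ m) m)

  coh-ι : ∀ z → Coh (ι z)
  coh-ι z = suc-coh (ι z) (λ _ → ≋-refl)

  coh-⊕ : ∀ a b → Coh a → Coh b → Coh (a ⊕ b)
  coh-⊕ a b ha hb = suc-coh (a ⊕ b) (λ m → +-cong≋ (coh-suc a ha m) (coh-suc b hb m))

  coh-⊗ : ∀ a b → Coh a → Coh b → Coh (a ⊗ b)
  coh-⊗ a b ha hb = suc-coh (a ⊗ b) (λ m → *-cong≋ (coh-suc a ha m) (coh-suc b hb m))

  coh-⊖ : ∀ a → Coh a → Coh (⊖ a)
  coh-⊖ a ha = suc-coh (⊖ a) (λ m → neg-cong≋ (coh-suc a ha m))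

  unscale-p^ : ∀ e m → + (p ℕ.^ e) * x ≋ + (p ℕ.^ e) * y [ p ℕ.^ (e ℕ.+ m) ] → x ≋ y [ p ℕ.^ m ]
  unscale-p^ {x} {y} e m h = ≋-unscale (p ℕ.^ e) {{p^-nonZero e}}
    (subst (+ (p ℕ.^ e) * x ≋ + (p ℕ.^ e) * y [_]) (ℕ.^-distribˡ-+-* p e m) h)

  scale-p^ : ∀ e m → x ≋ y [ p ℕ.^ m ] → + (p ℕ.^ e) * x ≋ + (p ℕ.^ e) * y [ p ℕ.^ (e ℕ.+ m) ]
  scale-p^ {x} {y} e m h = subst (+ (p ℕ.^ e) * x ≋ + (p ℕ.^ e) * y [_]) (sym (ℕ.^-distribˡ-+-* p e m)) (≋-scale (p ℕ.^ e) h)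

  p^≋0 : ∀ {e m} → m ≤ e → + (p ℕ.^ e) ≋ + 0 [ p ℕ.^ m ]
  p^≋0 {e} {m} m≤e = ≋-lower {m = m} {e} m≤e (∣⇒≋0 ∣-refl)

  p^*≋0 : ∀ {e m} x → m ≤ e → + (p ℕ.^ e) * x ≋ + 0 [ p ℕ.^ m ]
  p^*≋0 x m≤e = *≋0ˡ x (p^≋0 m≤e)

  unscale-p^-≋0 : ∀ e m → + (p ℕ.^ e) * x ≋ + 0 [ p ℕ.^ (e ℕ.+ m) ] → x ≋ + 0 [ p ℕ.^ m ]
  unscale-p^-≋0 e m h = unscale-p^ e m (≋-trans h (≋-reflexive (sym (ℤ.*-zeroʳ (+ (p ℕ.^ e))))))

  scale-p^-≋0 : ∀ e m → x ≋ + 0 [ p ℕ.^ m ] → + (p ℕ.^ e) * x ≋ + 0 [ p ℕ.^ (e ℕ.+ m) ]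
  scale-p^-≋0 e m h = ≋-trans (scale-p^ e m h) (≋-reflexive (ℤ.*-zeroʳ (+ (p ℕ.^ e))))

  -- Cancelling `p^e` costs `e` levels of precision, so level `m` is obtained from level `e + m`,
  -- and coherence leads back down.
  ⊗-cancel-p^ : ∀ e a b → Coh a → Coh b → (ι (+ (p ℕ.^ e)) ⊗ a) ≈ₚ (ι (+ (p ℕ.^ e)) ⊗ b) → a ≈ₚ b
  ⊗-cancel-p^ e a b ha hb h = levelwise a b λ m →
    ≋-trans (≋-sym (coh-+ a ha e m))
      (≋-trans (unscale-p^ e m (at (ι (+ (p ℕ.^ e)) ⊗ a) (ι (+ (p ℕ.^ e)) ⊗ b) h (e ℕ.+ m)))
               (coh-+ b hb e m))

  -- Level `m` of the quotient is the exact integer quotient of `a (e + m)` by `p^e`; that shift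
  -- supplies the precision lost in the division.
  divide-p^ : ∀ e a → Coh a → a e ≋ + 0 [ p ℕ.^ e ] → ∃ λ u → Coh u × a ≈ₚ (ι (+ (p ℕ.^ e)) ⊗ u)
  divide-p^ e a ha a-div = u , suc-coh u u-coh , levelwise a (ι P ⊗ u) a≈Pu
    where
    P = + (p ℕ.^ e)
    P∣a : ∀ m → P ∣ a (e ℕ.+ m)
    P∣a m = ≋0⇒∣ (≋-trans (coh-≤ a ha (ℕ.m≤m+n e m)) a-div)
    u : Seq
    u m = _∣_.quotient (P∣a m)
    a≡Pu : ∀ m → a (e ℕ.+ m) ≡ P * u m
    a≡Pu m = trans (_∣_.equality (P∣a m)) (ℤ.*-comm (u m) P)
    u-coh : ∀ m → u (suc m) ≋ u m [ p ℕ.^ m ]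
    u-coh m = unscale-p^ e m (≋-trans (≋-reflexive (sym (a≡Pu (suc m))))
      (≋-trans (subst (λ t → a t ≋ a (e ℕ.+ m) [ p ℕ.^ (e ℕ.+ m) ]) (sym (ℕ.+-suc e m)) (coh-suc a ha (e ℕ.+ m)))
               (≋-reflexive (a≡Pu m))))
    a≈Pu : ∀ m → a m ≋ P * u m [ p ℕ.^ m ]
    a≈Pu m = ≋-trans (≋-sym (coh-+ a ha e m)) (≋-reflexive (a≡Pu m))

  p∤1 : ¬ (+ p Unsigned.∣ + 1)
  p∤1 p∣1 = ℕ.nonTrivial⇒≢1 {{prime⇒nonTrivial p-prime}} (ℕ.∣1⇒≡1 p∣1)

  -- Induction on `m` in place of an inverse of `v`: Euclid's lemma extracts one factor `p` from
  -- `x`, and it is cancelled against one factor of the modulus.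
  cancel-nonmultiple : ∀ v → ¬ (+ p Unsigned.∣ v) → ∀ m → v * x ≋ + 0 [ p ℕ.^ m ] → x ≋ + 0 [ p ℕ.^ m ]
  cancel-nonmultiple         v p∤v zero    _ = ∣⇒≋0 (∣ᵤ⇒∣ (ℕ.1∣ _))
  cancel-nonmultiple {x} v p∤v (suc m) h
    with euclidsLemma ∣ v ∣ ∣ x ∣ p-prime
           (subst (p ℕ.∣_) (ℤ.abs-* v x) (ℕ.∣-trans (ℕ.m∣m*n (p ℕ.^ m)) (∣⇒∣ᵤ (≋0⇒∣ h))))
  ... | inj₁ p∣v = contradiction p∣v p∤v
  ... | inj₂ p∣x with divides y refl ← ∣ᵤ⇒∣ {+ p} {x} p∣x =
    ≋-trans (≋-reflexive (ℤ.*-comm y (+ p)))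
      (≋-trans (≋-scale p (cancel-nonmultiple v p∤v m (≋-unscale p (≋-trans (≋-reflexive (regroup (+ p) v y))
        (≋-trans h (≋-reflexive (sym (ℤ.*-zeroʳ (+ p)))))))))
        (≋-reflexive (ℤ.*-zeroʳ (+ p))))
    where
    regroup : ∀ p v y → p * (v * y) ≡ v * (y * p)
    regroup = solve-∀

  -- `IsUnit` tests level 1 alone. Coherence carries the test to all higher levels, but not to level
  -- 0, where residues modulo 1 say nothing.
  unit-nonmultiple : ∀ u → IsUnit u → ∀ m → ¬ (+ p Unsigned.∣ u (suc m))
  unit-nonmultiple u (u-coh , p∤u₁) m p∣u = p∤u₁ (∣⇒∣ᵤ (≋0⇒∣ u₁≋0))
    where
    u₁≋0 : u 1 ≋ + 0 [ p ]
    u₁≋0 = ≋-trans (≋-sym (subst (u (suc m) ≋ u 1 [_]) (ℕ.*-identityʳ p) (coh-≤ u u-coh (ℕ.s≤s ℕ.z≤n))))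
                   (∣⇒≋0 (∣ᵤ⇒∣ {+ p} {u (suc m)} p∣u))

  unit-cancel : ∀ u → IsUnit u → ∀ m → u m * x ≋ + 0 [ p ℕ.^ m ] → x ≋ + 0 [ p ℕ.^ m ]
  unit-cancel u u-unit zero  _ = ∣⇒≋0 (∣ᵤ⇒∣ (ℕ.1∣ _))
  unit-cancel u u-unit (suc m) h = cancel-nonmultiple (u (suc m)) (unit-nonmultiple u u-unit m) (suc m) h

-- The form J and symplectic duality.

module Symplectic (p : ℕ) (p-prime : Prime p) (n : ℕ) where
  open Hecke p n
  open PadicProperties p p-prime

  -- `J` is a signed permutation matrix: the only nonzero entry of row `i` is `sgn i`, in column
  -- `σ i`.
  σ : Fin N → Fin N
  σ i = Fin.join n n (Sum⊎.swap (Fin.splitAt n i))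

  sgn : Fin N → ℤ
  sgn i = Sum⊎.[ (λ _ → + 1) , (λ _ → - (+ 1)) ] (Fin.splitAt n i)

  splitAt-σ : ∀ i → Fin.splitAt n (σ i) ≡ Sum⊎.swap (Fin.splitAt n i)
  splitAt-σ i = Fin.splitAt-join n n _

  σ-involutive : ∀ i → σ (σ i) ≡ i
  σ-involutive i = begin
    Fin.join n n (Sum⊎.swap (Fin.splitAt n (σ i)))            ≡⟨ cong (Fin.join n n ∘ Sum⊎.swap) (splitAt-σ i) ⟩
    Fin.join n n (Sum⊎.swap (Sum⊎.swap (Fin.splitAt n i)))    ≡⟨ cong (Fin.join n n) (swap-involutive (Fin.splitAt n i)) ⟩
    Fin.join n n (Fin.splitAt n i)                            ≡⟨ Fin.join-splitAt n n i ⟩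
    i                                                         ∎
    where
    open ≡-Reasoning

  sgn*sgn : ∀ i → sgn i * sgn i ≡ + 1
  sgn*sgn i with Fin.splitAt n i
  ... | inj₁ _ = refl
  ... | inj₂ _ = refl

  sgn-cancel : ∀ i {x} → sgn i * x ≋ + 0 [ q ] → x ≋ + 0 [ q ]
  sgn-cancel i {x} h = ≋-trans (≋-reflexive (begin
    x                        ≡⟨ ℤ.*-identityˡ x ⟨
    + 1 * x                  ≡⟨ cong (_* x) (sgn*sgn i) ⟨
    sgn i * sgn i * x        ≡⟨ ℤ.*-assoc (sgn i) (sgn i) x ⟩
    sgn i * (sgn i * x)      ∎)) (*≋0ʳ (sgn i) h)
    where open ≡-Reasoning

  J-σ : ∀ r m → J r (σ r) m ≡ sgn r
  J-σ r m with Fin.splitAt n r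
  J-σ r m | inj₁ a rewrite Fin.splitAt-↑ʳ n n a with a Fin.≟ a
  ... | yes _  = refl
  ... | no a≢a = contradiction refl a≢a
  J-σ r m | inj₂ a rewrite Fin.splitAt-↑ˡ n a n with a Fin.≟ a
  ... | yes _  = refl
  ... | no a≢a = contradiction refl a≢a

  J-off : ∀ r u m → u ≢ σ r → J r u m ≡ + 0
  J-off r u m u≢σr with Fin.splitAt n r | Fin.splitAt n u in eq
  ... | inj₁ a | inj₁ b = refl
  ... | inj₂ a | inj₂ b = refl
  ... | inj₁ a | inj₂ b with a Fin.≟ b
  ...   | yes refl = contradiction (sym (Fin.splitAt⁻¹-↑ʳ eq)) u≢σr
  ...   | no _     = refl
  J-off r u m u≢σr | inj₂ a | inj₁ b with a Fin.≟ b
  ...   | yes refl = contradiction (sym (Fin.splitAt⁻¹-↑ˡ eq)) u≢σr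
  ...   | no _     = refl

  ΣF-level : ∀ {k} (f : Fin k → Seq) m → ΣF f m ≡ sum (λ i → f i m)
  ΣF-level {zero}  f m = refl
  ΣF-level {suc k} f m = cong (λ t → f zero m + t) (ΣF-level (f ∘ suc) m)

  J⟨·⟩ : ∀ r m (x : Fin N → ℤ) → (λ u → J r u m) ⟨·⟩ x ≡ sgn r * x (σ r)
  J⟨·⟩ r m x = trans
    (sum-single (σ r) λ u u≢σr → trans (cong (_* x u) (J-off r u m u≢σr)) (ℤ.*-zeroˡ (x u)))
    (cong (_* x (σ r)) (J-σ r m))

  -- The left side is entry `(r , u)` of ᵗA J A with the product by `J` already carried out, which
  -- leaves one sum instead of two.
  IsSymplectic : ℕ → (Fin N → Fin N → ℤ) → ℤ → Set
  IsSymplectic m A μ = ∀ r u →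
    sum (λ s → A s r * (sgn s * A (σ s) u)) ≋ μ * J r u m [ p ℕ.^ m ]

  ᵗAJA-level : ∀ (A : Mat) r u m →
    (tr A · (J · A)) r u m ≡ sum (λ s → A s r m * (sgn s * A (σ s) u m))
  ᵗAJA-level A r u m = trans (ΣF-level (λ s → A s r ⊗ (J · A) s u) m)
    (Sum.sum-cong-≗ λ s → cong (A s r m *_)
      (trans (ΣF-level (λ t → J s t ⊗ A t u) m) (J⟨·⟩ s m (λ t → A t u m))))

  -- A x = y implies ᵗA J y = μ J x; entry s of J y is sgn s * y (σ s).
  symplectic-dual : ∀ m A μ → IsSymplectic m A μ → ∀ (x y : Fin N → ℤ) →
    (∀ t → A t ⟨·⟩ x ≋ y t [ p ℕ.^ m ]) →
    ∀ r → sum (λ s → A s r * (sgn s * y (σ s))) ≋ μ * (sgn r * x (σ r)) [ p ℕ.^ m ]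
  symplectic-dual m A μ A-symp x y Ax≋y r =
    ≋-trans (sum-cong≋ λ s → *-congˡ≋ (A s r) (*-congˡ≋ (sgn s) (≋-sym (Ax≋y (σ s)))))
    (≋-trans (≋-reflexive expand)
    (≋-trans (sum-cong≋ λ u → *-cong≋ (A-symp r u) (≋-refl {x u}))
    (≋-reflexive collect)))
    where
    open ≡-Reasoning
    expand : sum (λ s → A s r * (sgn s * A (σ s) ⟨·⟩ x)) ≡
             sum (λ u → sum (λ s → A s r * (sgn s * A (σ s) u)) * x u)
    expand = begin
      sum (λ s → A s r * (sgn s * A (σ s) ⟨·⟩ x))
        ≡⟨ Sum.sum-cong-≗ (λ s → ℤ.*-assoc (A s r) (sgn s) (A (σ s) ⟨·⟩ x)) ⟨
      sum (λ s → A s r * sgn s * A (σ s) ⟨·⟩ x)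
        ≡⟨ ⟨·⟩-assoc (λ s → A s r * sgn s) (A ∘ σ) x ⟩
      sum (λ u → sum (λ s → A s r * sgn s * A (σ s) u) * x u)
        ≡⟨ Sum.sum-cong-≗ (λ u → cong (_* x u) (Sum.sum-cong-≗ λ s → ℤ.*-assoc (A s r) (sgn s) (A (σ s) u))) ⟩
      sum (λ u → sum (λ s → A s r * (sgn s * A (σ s) u)) * x u) ∎
    collect : sum (λ u → μ * J r u m * x u) ≡ μ * (sgn r * x (σ r))
    collect = begin
      sum (λ u → μ * J r u m * x u)        ≡⟨ Sum.sum-cong-≗ (λ u → ℤ.*-assoc μ (J r u m) (x u)) ⟩
      sum (λ u → μ * (J r u m * x u))      ≡⟨ Sum.*-distribˡ-sum μ (λ u → J r u m * x u) ⟨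
      μ * (λ u → J r u m) ⟨·⟩ x            ≡⟨ cong (μ *_) (J⟨·⟩ r m x) ⟩
      μ * (sgn r * x (σ r))                ∎

  -- For `y` supported at `j` only the term `s = σ j` survives in the sum. Thus a single known
  -- product A x gives divisibility information about a whole row of A.
  symplectic-dual-single : ∀ m A μ → IsSymplectic m A μ → ∀ (x y : Fin N → ℤ) →
    (∀ t → A t ⟨·⟩ x ≋ y t [ p ℕ.^ m ]) → ∀ j → (∀ t → t ≢ j → y t ≡ + 0) →
    ∀ r → A (σ j) r * (sgn (σ j) * y j) ≋ μ * (sgn r * x (σ r)) [ p ℕ.^ m ]
  symplectic-dual-single m A μ A-symp x y Ax≋y j y-single r =
    ≋-trans (≋-reflexive (sym (begin
      sum (λ s → A s r * (sgn s * y (σ s)))        ≡⟨ sum-single (σ j) off ⟩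
      A (σ j) r * (sgn (σ j) * y (σ (σ j)))        ≡⟨ cong (λ t → A (σ j) r * (sgn (σ j) * y t)) (σ-involutive j) ⟩
      A (σ j) r * (sgn (σ j) * y j)                ∎)))
    (symplectic-dual m A μ A-symp x y Ax≋y r)
    where
    open ≡-Reasoning
    σs≢j : ∀ s → s ≢ σ j → σ s ≢ j
    σs≢j s s≢σj σs≡j = s≢σj (trans (sym (σ-involutive s)) (cong σ σs≡j))
    kill : ∀ a b → a * (b * + 0) ≡ + 0
    kill = solve-∀
    off : ∀ s → s ≢ σ j → A s r * (sgn s * y (σ s)) ≡ + 0
    off s s≢σj = trans (cong (λ t → A s r * (sgn s * t)) (y-single (σ s) (σs≢j s s≢σj))) (kill (A s r) (sgn s))

-- Elements of the monoid level by level, and diagonal elements.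

module Elements (p : ℕ) (p-prime : Prime p) (n : ℕ) where
  open Hecke p n
  open PadicProperties p p-prime
  open Symplectic p p-prime n

  coh-ΣF : ∀ {k} (f : Fin k → Seq) → (∀ i → Coh (f i)) → Coh (ΣF f)
  coh-ΣF {zero}  f hf = coh-ι (+ 0)
  coh-ΣF {suc k} f hf = coh-⊕ (f zero) (ΣF (f ∘ suc)) (hf zero) (coh-ΣF (f ∘ suc) (hf ∘ suc))

  coh-· : ∀ A B → (∀ i j → Coh (A i j)) → (∀ i j → Coh (B i j)) → ∀ i j → Coh ((A · B) i j)
  coh-· A B hA hB i j = coh-ΣF (λ r → A i r ⊗ B r j) (λ r → coh-⊗ (A i r) (B r j) (hA i r) (hB r j))

  coh-▹ : ∀ A v → (∀ i j → Coh (A i j)) → (∀ i → Coh (v i)) → ∀ i → Coh ((A ▹ v) i)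
  coh-▹ A v hA hv i = coh-ΣF (λ r → A i r ⊗ v r) (λ r → coh-⊗ (A i r) (v r) (hA i r) (hv r))

  coh-J : ∀ i j → Coh (J i j)
  coh-J i j = suc-coh (J i j) (λ m → ≋-reflexive (constant m))
    where
    constant : ∀ m → J i j (suc m) ≡ J i j m
    constant m with j Fin.≟ σ i
    ... | yes refl = trans (J-σ i (suc m)) (sym (J-σ i m))
    ... | no j≢σi  = trans (J-off i j (suc m) j≢σi) (sym (J-off i j m j≢σi))

  level : ℕ → Mat → Fin N → Fin N → ℤ
  level m A i j = A i j m

  levelᶜ : ℕ → Col → Fin N → ℤ
  levelᶜ m v i = v i m

  column : Fin N → (Fin N → Fin N → ℤ) → Fin N → ℤ
  column j A i = A i j

  ·-level : ∀ A B i j m → (A · B) i j m ≡ level m A i ⟨·⟩ column j (level m B)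
  ·-level A B i j m = ΣF-level (λ r → A i r ⊗ B r j) m

  ▹-level : ∀ A v i m → (A ▹ v) i m ≡ level m A i ⟨·⟩ levelᶜ m v
  ▹-level A v i m = ΣF-level (λ r → A i r ⊗ v r) m

  symplectic-level : ∀ A μ → (tr A · (J · A)) ≈ᴹ (μ *ᴹ J) → ∀ m → IsSymplectic m (level m A) (μ m)
  symplectic-level A μ h m r u = ≋-trans (≋-reflexive (sym (ᵗAJA-level A r u m)))
    (at ((tr A · (J · A)) r u) (μ ⊗ J r u) (h r u) m)

  symplectic-levelwise : ∀ A μ → (∀ m → IsSymplectic m (level m A) (μ m)) → (tr A · (J · A)) ≈ᴹ (μ *ᴹ J)
  symplectic-levelwise A μ h r u = levelwise ((tr A · (J · A)) r u) (μ ⊗ J r u) λ m →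
    ≋-trans (≋-reflexive (ᵗAJA-level A r u m)) (h m r u)

  ∘̃-mat-level : ∀ x y z → (x ∘̃ y) ≈ᴱ z → ∀ m i j →
    level m (mat x) i ⟨·⟩ column j (level m (mat y)) ≋ mat z i j m [ p ℕ.^ m ]
  ∘̃-mat-level x y z (h , _ , _) m i j = ≋-trans (≋-reflexive (sym (·-level (mat x) (mat y) i j m)))
    (at ((mat x · mat y) i j) (mat z i j) (h i j) m)

  ∘̃-vec-level : ∀ x y z → (x ∘̃ y) ≈ᴱ z → ∀ m i →
    level m (mat x) i ⟨·⟩ levelᶜ m (vec y) + mult y m * vec x i m ≋ vec z i m [ p ℕ.^ m ]
  ∘̃-vec-level x y z (_ , h , _) m i =
    ≋-trans (≋-reflexive (cong (λ t → t + mult y m * vec x i m) (sym (▹-level (mat x) (vec y) i m))))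
    (at ((mat x ▹ vec y) i ⊕ (mult y ⊗ vec x i)) (vec z i) (h i) m)
  mult-≋0 : ∀ x e → HasVal x e → ∀ {m} → m ≤ e → x m ≋ + 0 [ p ℕ.^ m ]
  mult-≋0 x e (u , _ , x≈p^e*u) {m} m≤e =
    ≋-trans (at x (ι (+ (p ℕ.^ e)) ⊗ u) x≈p^e*u m) (p^*≋0 (u m) m≤e)

  diagℤ : (Fin N → ℕ) → Fin N → Fin N → ℤ
  diagℤ e i j with i Fin.≟ j
  ... | yes _ = + (p ℕ.^ e i)
  ... | no  _ = + 0

  diagℤ-on : ∀ e i → diagℤ e i i ≡ + (p ℕ.^ e i)
  diagℤ-on e i with i Fin.≟ i
  ... | yes _  = refl
  ... | no i≢i = contradiction refl i≢i

  diagℤ-off : ∀ e {i j} → i ≢ j → diagℤ e i j ≡ + 0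
  diagℤ-off e {i} {j} i≢j with i Fin.≟ j
  ... | yes i≡j = contradiction i≡j i≢j
  ... | no _    = refl

  diagℤ⟨·⟩ : ∀ e i (x : Fin N → ℤ) → diagℤ e i ⟨·⟩ x ≡ + (p ℕ.^ e i) * x i
  diagℤ⟨·⟩ e i x = trans
    (sum-single i λ r r≢i → trans (cong (_* x r) (diagℤ-off e (r≢i ∘ sym))) (ℤ.*-zeroˡ (x r)))
    (cong (_* x i) (diagℤ-on e i))

  ⟨·⟩diagℤ : ∀ e (x : Fin N → ℤ) j → x ⟨·⟩ column j (diagℤ e) ≡ + (p ℕ.^ e j) * x j
  ⟨·⟩diagℤ e x j = trans
    (sum-single j λ r r≢j → trans (cong (x r *_) (diagℤ-off e r≢j)) (ℤ.*-zeroʳ (x r)))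
    (trans (cong (x j *_) (diagℤ-on e j)) (ℤ.*-comm (x j) _))

  p^-+ : ∀ e f → + (p ℕ.^ (e ℕ.+ f)) ≡ + (p ℕ.^ e) * + (p ℕ.^ f)
  p^-+ e f = trans (cong +_ (ℕ.^-distribˡ-+-* p e f)) (ℤ.pos-* (p ℕ.^ e) (p ℕ.^ f))

  diagℤ-+ : ∀ (e f : Fin N → ℕ) i j → diagℤ (λ r → e r ℕ.+ f r) i j ≡ + (p ℕ.^ f j) * diagℤ e i j
  diagℤ-+ e f i j with i Fin.≟ j
  ... | yes refl = trans (p^-+ (e i) (f i)) (ℤ.*-comm (+ (p ℕ.^ e i)) (+ (p ℕ.^ f i)))
  ... | no _     = sym (ℤ.*-zeroʳ (+ (p ℕ.^ f j)))

  diag : (Fin N → ℕ) → Mat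
  diag e i j = ι (diagℤ e i j)

  diagElt : (Fin N → ℕ) → (Fin N → ℤ) → ℕ → Elt
  diagElt e v k = ⟨ diag e , (λ i → ι (v i)) , ι (+ (p ℕ.^ k)) ⟩

  -- For D = diag(p^e), entry `(r , σ r)` of ᵗD J D is `sgn r` times `p^(e r + e (σ r))`, and the
  -- remaining entries vanish. The unit part of the multiplier is 1.
  diagElt∈Δ̃ : ∀ e v k → (∀ i → e i ℕ.+ e (σ i) ≡ k) → Δ̃ k (diagElt e v k)
  diagElt∈Δ̃ e v k e+eσ≡k =
    (λ i j → coh-ι (diagℤ e i j)) , (λ i → coh-ι (v i)) , coh-ι P ,
    symplectic-levelwise (diag e) (ι (+ (p ℕ.^ k))) (λ m r u → ≋-reflexive (symp m r u)) ,
    (ι (+ 1) , (coh-ι (+ 1) , p∤1) , levelwise (ι P) (ι P ⊗ ι (+ 1)) λ m → ≋-reflexive (sym (ℤ.*-identityʳ P)))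
    where
    P = + (p ℕ.^ k)
    open ≡-Reasoning
    swap : ∀ a b c → a * (b * c) ≡ a * c * b
    swap = solve-∀
    symp : ∀ m r u → sum (λ s → diagℤ e s r * (sgn s * diagℤ e (σ s) u)) ≡ + (p ℕ.^ k) * J r u m
    symp m r u = begin
      sum (λ s → diagℤ e s r * (sgn s * diagℤ e (σ s) u))
        ≡⟨ Sum.sum-cong-≗ (λ s → ℤ.*-comm (diagℤ e s r) (sgn s * diagℤ e (σ s) u)) ⟩
      (λ s → sgn s * diagℤ e (σ s) u) ⟨·⟩ column r (diagℤ e)
        ≡⟨ ⟨·⟩diagℤ e (λ s → sgn s * diagℤ e (σ s) u) r ⟩
      + (p ℕ.^ e r) * (sgn r * diagℤ e (σ r) u)
        ≡⟨ last ⟩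
      + (p ℕ.^ k) * J r u m ∎
      where
      last : + (p ℕ.^ e r) * (sgn r * diagℤ e (σ r) u) ≡ + (p ℕ.^ k) * J r u m
      last with u Fin.≟ σ r
      ... | yes refl = begin
        + (p ℕ.^ e r) * (sgn r * diagℤ e (σ r) (σ r))      ≡⟨ cong (λ t → + (p ℕ.^ e r) * (sgn r * t)) (diagℤ-on e (σ r)) ⟩
        + (p ℕ.^ e r) * (sgn r * + (p ℕ.^ e (σ r)))        ≡⟨ swap (+ (p ℕ.^ e r)) (sgn r) (+ (p ℕ.^ e (σ r))) ⟩
        + (p ℕ.^ e r) * + (p ℕ.^ e (σ r)) * sgn r          ≡⟨ cong (_* sgn r) (p^-+ (e r) (e (σ r))) ⟨
        + (p ℕ.^ (e r ℕ.+ e (σ r))) * sgn r                ≡⟨ cong₂ (λ s t → + (p ℕ.^ s) * t) (e+eσ≡k r) (sym (J-σ r m)) ⟩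
        + (p ℕ.^ k) * J r (σ r) m                          ∎
      ... | no u≢σr = begin
        + (p ℕ.^ e r) * (sgn r * diagℤ e (σ r) u)          ≡⟨ cong (λ t → + (p ℕ.^ e r) * (sgn r * t)) (diagℤ-off e (u≢σr ∘ sym)) ⟩
        + (p ℕ.^ e r) * (sgn r * + 0)                      ≡⟨ kill (+ (p ℕ.^ e r)) (sgn r) (+ (p ℕ.^ k)) ⟩
        + (p ℕ.^ k) * + 0                                  ≡⟨ cong (+ (p ℕ.^ k) *_) (J-off r u m u≢σr) ⟨
        + (p ℕ.^ k) * J r u m                              ∎
        where
        kill : ∀ a b c → a * (b * + 0) ≡ c * + 0
        kill = solve-∀

-- The element `γ` and its vanishing coefficient.

module Counterexample (p : ℕ) (p-prime : Prime p) (n′ k′ l : ℕ) (k<l : suc k′ < l) where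
  n k : ℕ
  n = suc n′
  k = suc k′

  open Hecke p n
  open PadicProperties p p-prime
  open Symplectic p p-prime n
  open Elements p p-prime n

  k≤l : k ≤ l
  k≤l = ℕ.<⇒≤ k<l

  o o′ : Fin N
  o  = zero
  o′ = σ o

  half₁ half₂ : Fin n → ℕ
  half₁ zero    = 1
  half₁ (suc _) = 0
  half₂ zero    = k′
  half₂ (suc _) = k

  indicator₀ : Fin n → ℤ
  indicator₀ zero    = + 1
  indicator₀ (suc _) = + 0

  a b : Fin N → ℕ
  a i = Sum⊎.[ half₁ , half₂ ] (Fin.splitAt n i)
  b i = Sum⊎.[ (λ _ → 0) , (λ _ → l) ] (Fin.splitAt n i)

  -- `c′` is the basis column at `o′`. Since `c` is diag(p^a) applied to it, a factorisation with
  -- left multiplier `p^k` exists, and `c′` serves as base point for all of them.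
  c′ c : Fin N → ℤ
  c′ i = Sum⊎.[ (λ _ → + 0) , indicator₀ ] (Fin.splitAt n i)
  c i = + (p ℕ.^ a i) * c′ i

  a+b : Fin N → ℕ
  a+b i = a i ℕ.+ b i

  γ : Elt
  γ = diagElt a+b c (k ℕ.+ l)

  a+aσ : ∀ i → a i ℕ.+ a (σ i) ≡ k
  a+aσ i rewrite splitAt-σ i with Fin.splitAt n i
  ... | inj₁ zero    = refl
  ... | inj₁ (suc _) = refl
  ... | inj₂ zero    = ℕ.+-comm k′ 1
  ... | inj₂ (suc _) = ℕ.+-identityʳ k

  b+bσ : ∀ i → b i ℕ.+ b (σ i) ≡ l
  b+bσ i rewrite splitAt-σ i with Fin.splitAt n i
  ... | inj₁ _ = refl
  ... | inj₂ _ = ℕ.+-identityʳ l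

  a≤k : ∀ i → a i ≤ k
  a≤k i = subst (a i ≤_) (a+aσ i) (ℕ.m≤m+n (a i) (a (σ i)))

  a≤l : ∀ i → a i ≤ l
  a≤l i = ℕ.≤-trans (a≤k i) k≤l

  γ∈Δ̃ : Δ̃ (k ℕ.+ l) γ
  γ∈Δ̃ = diagElt∈Δ̃ a+b c (k ℕ.+ l) λ i → begin
    a i ℕ.+ b i ℕ.+ (a (σ i) ℕ.+ b (σ i))      ≡⟨ interchange ℕ.+-commutativeSemigroup (a i) (b i) (a (σ i)) (b (σ i)) ⟩
    a i ℕ.+ a (σ i) ℕ.+ (b i ℕ.+ b (σ i))      ≡⟨ cong₂ ℕ._+_ (a+aσ i) (b+bσ i) ⟩
    k ℕ.+ l                                    ∎
    where open ≡-Reasoning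

  splitAt-o′ : Fin.splitAt n o′ ≡ inj₂ zero
  splitAt-o′ = splitAt-σ o

  c-o′ : c o′ ≡ + (p ℕ.^ k′)
  c-o′ rewrite splitAt-o′ = ℤ.*-identityʳ (+ (p ℕ.^ k′))

  c-off : ∀ i → i ≢ o′ → c i ≡ + 0
  c-off i i≢o′ with Fin.splitAt n i in eq
  ... | inj₁ j       = ℤ.*-zeroʳ (+ (p ℕ.^ half₁ j))
  ... | inj₂ zero    = contradiction (sym (Fin.splitAt⁻¹-↑ʳ eq)) i≢o′
  ... | inj₂ (suc _) = ℤ.*-zeroʳ (+ (p ℕ.^ k))

  regroup : ∀ x s y → x * (s * y) ≡ s * (y * x)
  regroup = solve-∀

  -- Common ground for both orders of multiplication: `e` is the valuation for the right factor `δ`,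
  -- `f` the one for the left factor `α`.
  module Factorisation (e f : ℕ) (δ α : Elt) (δ∈ : Δ̃ e δ) (α∈ : Δ̃ f α) (αδ≈γ : (α ∘̃ δ) ≈ᴱ γ) where

    A B : ℕ → Fin N → Fin N → ℤ
    A m = level m (mat α)
    B m = level m (mat δ)

    A-coh : ∀ i j → Coh (mat α i j)
    A-coh = proj₁ α∈

    B-coh : ∀ i j → Coh (mat δ i j)
    B-coh = proj₁ δ∈

    vec-coh : ∀ i → Coh (vec δ i)
    vec-coh = proj₁ (proj₂ δ∈)

    A-symp : ∀ m → IsSymplectic m (A m) (mult α m)
    A-symp = symplectic-level (mat α) (mult α) (proj₁ (proj₂ (proj₂ (proj₂ α∈))))

    B-symp : ∀ m → IsSymplectic m (B m) (mult δ m)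
    B-symp = symplectic-level (mat δ) (mult δ) (proj₁ (proj₂ (proj₂ (proj₂ δ∈))))

    α-val : HasVal (mult α) f
    α-val = proj₂ (proj₂ (proj₂ (proj₂ α∈)))

    δ-val : HasVal (mult δ) e
    δ-val = proj₂ (proj₂ (proj₂ (proj₂ δ∈)))

    A·B : ∀ m i j → A m i ⟨·⟩ column j (B m) ≋ diagℤ a+b i j [ p ℕ.^ m ]
    A·B = ∘̃-mat-level α δ γ αδ≈γ

    -- Up to level `e` the multiplier of `δ` is 0, so the unknown column `vec α` drops out of the
    -- product.
    A·vec : ∀ m → m ≤ e → ∀ i → A m i ⟨·⟩ levelᶜ m (vec δ) ≋ c i [ p ℕ.^ m ]
    A·vec m m≤e i = ≋-trans (≋-reflexive (sym (ℤ.+-identityʳ Av)))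
      (≋-trans (+-cong≋ (≋-refl {Av}) (≋-sym (*≋0ˡ (vec α i m) (mult-≋0 (mult δ) e δ-val m≤e))))
               (∘̃-vec-level α δ γ αδ≈γ m i))
      where
      Av : ℤ
      Av = A m i ⟨·⟩ levelᶜ m (vec δ)

    -- Column `j` of the matrix C of `γ` has a single nonzero entry. Duality therefore trades row
    -- `σ j` of A for column `j` of B; this is the entrywise form of ᵗA J C = μ(A) J B.
    dual-column : ∀ m j r →
      sgn (σ j) * (+ (p ℕ.^ a+b j) * A m (σ j) r) ≋ mult α m * (sgn r * B m (σ r) j) [ p ℕ.^ m ]
    dual-column m j r = ≋-trans
      (≋-reflexive (trans (cong (λ t → sgn (σ j) * (t * A m (σ j) r)) (sym (diagℤ-on a+b j)))
                          (sym (regroup (A m (σ j) r) (sgn (σ j)) (diagℤ a+b j j)))))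
      (symplectic-dual-single m (A m) (mult α m) (A-symp m)
        (column j (B m)) (column j (diagℤ a+b)) (λ t → A·B m t j) j (λ t t≢j → diagℤ-off a+b t≢j) r)

  shift-k′ : ∀ {x} → + (p ℕ.^ k′) * x ≋ + 0 [ p ℕ.^ k ] → x ≋ + 0 [ p ℕ.^ 1 ]
  shift-k′ {x} h = unscale-p^-≋0 k′ 1 (subst (λ t → + (p ℕ.^ k′) * x ≋ + 0 [ p ℕ.^ t ]) (ℕ.+-comm 1 k′) h)

  l₁ : ℕ
  l₁ = ℕ.pred l

  1+l₁≡l : suc l₁ ≡ l
  1+l₁≡l = ℕ.suc-pred l {{ℕ.>-nonZero (ℕ.≤-<-trans ℕ.z≤n k<l)}}

  -- Strictness of `k < l` matters here: row `o′` of A is only known to be divisible by p^(l-1), and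
  -- this has to reach p^k.
  k≤l₁ : k ≤ l₁
  k≤l₁ = ℕ.s≤s⁻¹ (subst (suc k ≤_) (sym 1+l₁≡l) k<l)

  Mset-l-k-empty : ∀ δ → ¬ Mset l k γ δ
  Mset-l-k-empty δ (δ∈ , α , α∈ , αδ≈γ) = p∤1 (∣⇒∣ᵤ (≋0⇒∣ (subst (+ 1 ≋ + 0 [_]) (ℕ.*-identityʳ p) 1≋0)))
    where
    open Factorisation k l δ α δ∈ α∈ αδ≈γ
    -- The exponent `a+b o` is 1 and `mult α` vanishes modulo p^l, so cancelling one `p` leaves
    -- p^(l-1). The computation takes place at level `l` and is then carried down to level `k`.
    row≋0 : ∀ r → A k o′ r ≋ + 0 [ p ℕ.^ k ]
    row≋0 r = ≋-trans (≋-sym (coh-≤ (mat α o′ r) (A-coh o′ r) k≤l)) (≋-lower {m = k} {l₁} k≤l₁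
      (unscale-p^-≋0 1 l₁ (sgn-cancel o′ (subst (λ t → sgn o′ * (+ (p ℕ.^ 1) * A l o′ r) ≋ + 0 [ p ℕ.^ t ]) (sym 1+l₁≡l)
        (≋-trans (dual-column l o r) (*≋0ˡ (sgn r * B l (σ r) o) (mult-≋0 (mult α) l α-val ℕ.≤-refl)))))))
    -- Row `o′` of A is 0 modulo p^k, whereas entry `o′` of `c` is p^(k-1).
    p^k′≋0 : + (p ℕ.^ k′) ≋ + 0 [ p ℕ.^ k ]
    p^k′≋0 = ≋-trans (≋-reflexive (sym c-o′)) (≋-trans (≋-sym (A·vec k ℕ.≤-refl o′))
      (sum≋0 λ r → *≋0ˡ (vec δ r k) (row≋0 r)))
    1≋0 : + 1 ≋ + 0 [ p ℕ.^ 1 ]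
    1≋0 = shift-k′ (≋-trans (≋-reflexive (ℤ.*-identityʳ (+ (p ℕ.^ k′)))) p^k′≋0)

-- Coset representatives for the coefficient in the other order.

module Representatives (p : ℕ) (p-prime : Prime p) (n′ k′ l : ℕ) (k<l : suc k′ < l) where
  open Counterexample p p-prime n′ k′ l k<l
  open Hecke p n
  open PadicProperties p p-prime
  open Symplectic p p-prime n
  open Elements p p-prime n

  l∸a+a : ∀ j → (l ℕ.∸ a j) ℕ.+ a j ≡ l
  l∸a+a j = ℕ.m∸n+n≡m (a≤l j)

  a+l∸a : ∀ j → a j ℕ.+ (l ℕ.∸ a j) ≡ l
  a+l∸a j = ℕ.m+[n∸m]≡n (a≤l j)

  Digits : Set
  Digits = ∀ j → Fin (p ℕ.^ a j)

  -- The solutions of p^aⱼ wⱼ ≡ cⱼ modulo pˡ.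
  w : Digits → Fin N → ℤ
  w t j = c′ j + + (p ℕ.^ (l ℕ.∸ a j)) * + toℕ (t j)

  rep : Digits → Elt
  rep t = diagElt b (w t) l

  rep∈Mset : ∀ t → Mset k l γ (rep t)
  rep∈Mset t = diagElt∈Δ̃ b (w t) l b+bσ , α , diagElt∈Δ̃ a v k a+aσ ,
    (λ i j → levelwise ((diag a · diag b) i j) (mat γ i j) λ m → ≋-reflexive (begin
      (diag a · diag b) i j m                  ≡⟨ ·-level (diag a) (diag b) i j m ⟩
      diagℤ a i ⟨·⟩ column j (diagℤ b)         ≡⟨ ⟨·⟩diagℤ b (diagℤ a i) j ⟩
      + (p ℕ.^ b j) * diagℤ a i j              ≡⟨ diagℤ-+ a b i j ⟨
      diagℤ a+b i j                            ∎)) ,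
    (λ i → levelwise (vec (α ∘̃ rep t) i) (vec γ i) λ m → ≋-reflexive (begin
      (diag a ▹ vec (rep t)) i m + P l * - + toℕ (t i)
        ≡⟨ cong (λ z → z + P l * - + toℕ (t i)) (trans (▹-level (diag a) (vec (rep t)) i m) (diagℤ⟨·⟩ a i (w t))) ⟩
      P (a i) * (c′ i + P (l ℕ.∸ a i) * + toℕ (t i)) + P l * - + toℕ (t i)
        ≡⟨ cong (λ z → P (a i) * (c′ i + P (l ℕ.∸ a i) * + toℕ (t i)) + z * - + toℕ (t i))
             (trans (cong P (sym (a+l∸a i))) (p^-+ (a i) (l ℕ.∸ a i))) ⟩
      P (a i) * (c′ i + P (l ℕ.∸ a i) * + toℕ (t i)) + P (a i) * P (l ℕ.∸ a i) * - + toℕ (t i)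
        ≡⟨ cancel (P (a i)) (c′ i) (P (l ℕ.∸ a i)) (+ toℕ (t i)) ⟩
      P (a i) * c′ i ∎)) ,
    levelwise (ι (P k) ⊗ ι (P l)) (ι (P (k ℕ.+ l))) (λ m → ≋-reflexive (sym (p^-+ k l)))
    where
    open ≡-Reasoning
    P : ℕ → ℤ
    P e = + (p ℕ.^ e)
    -- With the negated digits as left column, the term p^l v cancels the digit part of diag(p^a)
    -- `w t` and leaves `c`.
    v : Fin N → ℤ
    v j = - + toℕ (t j)
    α : Elt
    α = diagElt a v k
    cancel : ∀ x y z t → x * (y + z * t) + x * z * - t ≡ x * y
    cancel = solve-∀

  -- Cancelling p^b in the matrix equation makes the matrix of `u` the identity, written
  -- `diagℤ (λ _ → 0)`. The column of `u` enters with factor p^l, so `w s` and `w t` agree modulo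
  -- p^l, and their digits agree modulo p^aⱼ.
  rep-injective : ∀ s t → SameCoset (rep s) (rep t) → ∀ j → s j ≡ t j
  rep-injective s t (u , (U-coh , _) , us≈t) j = toℕ≋⇒≡ (s j) (t j)
    (unscale-p^ (l ℕ.∸ a j) (a j) (subst (λ e → digit s ≋ digit t [ p ℕ.^ e ]) (sym (l∸a+a j)) (+-cancel≋ w≋)))
    where
    digit : Digits → ℤ
    digit t = + (p ℕ.^ (l ℕ.∸ a j)) * + toℕ (t j)
    U≈1 : ∀ i r → mat u i r ≈ₚ ι (diagℤ (λ _ → 0) i r)
    U≈1 i r = ⊗-cancel-p^ (b r) (mat u i r) (ι (diagℤ (λ _ → 0) i r)) (U-coh i r) (coh-ι (diagℤ (λ _ → 0) i r))
      (levelwise (ι (+ (p ℕ.^ b r)) ⊗ mat u i r) (ι (+ (p ℕ.^ b r)) ⊗ ι (diagℤ (λ _ → 0) i r)) λ m →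
        ≋-trans (≋-reflexive (sym (⟨·⟩diagℤ b (level m (mat u) i) r)))
        (≋-trans (∘̃-mat-level u (rep s) (rep t) us≈t m i r) (≋-reflexive (diagℤ-+ (λ _ → 0) b i r))))
    Uw≋w : level l (mat u) j ⟨·⟩ w s ≋ w s j [ p ℕ.^ l ]
    Uw≋w = ≋-trans
      (sum-cong≋ λ r → *-cong≋ (at (mat u j r) (ι (diagℤ (λ _ → 0) j r)) (U≈1 j r) l) (≋-refl {w s r}))
      (≋-reflexive (trans (diagℤ⟨·⟩ (λ _ → 0) j (w s)) (ℤ.*-identityˡ (w s j))))
    w≋ : w s j ≋ w t j [ p ℕ.^ l ]
    w≋ = ≋-trans (≋-sym Uw≋w) (≋-trans
      (≋-trans (≋-reflexive (sym (ℤ.+-identityʳ Uw))) (+-cong≋ (≋-refl {Uw}) (≋-sym (p^*≋0 {l} {l} (vec u j l) ℕ.≤-refl))))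
      (∘̃-vec-level u (rep s) (rep t) us≈t l j))
      where
      Uw : ℤ
      Uw = level l (mat u) j ⟨·⟩ w s
    +-cancel≋ : w s j ≋ w t j [ p ℕ.^ l ] → digit s ≋ digit t [ p ℕ.^ l ]
    +-cancel≋ (mk≋ d) = mk≋ (subst (+ (p ℕ.^ l) ∣_) (drop (c′ j) (digit s) (digit t)) d)
      where
      drop : ∀ z x y → (z + x) - (z + y) ≡ x - y
      drop = solve-∀

  -- Reduction of an arbitrary right divisor to a representative.

  module RightDivisor (δ : Elt) (δ∈ : Δ̃ l δ) (α : Elt) (α∈ : Δ̃ k α) (αδ≈γ : (α ∘̃ δ) ≈ᴱ γ) where
    open Factorisation l k δ α δ∈ α∈ αδ≈γ

    ν ν-α : Seq
    ν = proj₁ δ-val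
    ν-α = proj₁ α-val

    ν-unit : IsUnit ν
    ν-unit = proj₁ (proj₂ δ-val)

    β≋p^l*ν : ∀ m → mult δ m ≋ + (p ℕ.^ l) * ν m [ p ℕ.^ m ]
    β≋p^l*ν = at (mult δ) (ι (+ (p ℕ.^ l)) ⊗ ν) (proj₂ (proj₂ δ-val))

    -- c is supported at o′, so duality for vec δ isolates row o of mat α.
    A-row-o : ∀ r → A k o r ≋ + 0 [ p ℕ.^ 1 ]
    A-row-o r = shift-k′ (sgn-cancel o (≋-trans (≋-reflexive (sym rearrange)) (≋-trans
      (symplectic-dual-single k (A k) (mult α k) (A-symp k) (levelᶜ k (vec δ)) c (A·vec k k≤l) o′ c-off r)
      (*≋0ˡ (sgn r * vec δ (σ r) k) (mult-≋0 (mult α) k α-val ℕ.≤-refl)))))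
      where
      open ≡-Reasoning
      rearrange : A k (σ o′) r * (sgn (σ o′) * c o′) ≡ sgn o * (+ (p ℕ.^ k′) * A k o r)
      rearrange = begin
        A k (σ o′) r * (sgn (σ o′) * c o′)          ≡⟨ cong₂ (λ i z → A k i r * (sgn i * z)) (σ-involutive o) c-o′ ⟩
        A k o r * (sgn o * + (p ℕ.^ k′))            ≡⟨ regroup (A k o r) (sgn o) (+ (p ℕ.^ k′)) ⟩
        sgn o * (+ (p ℕ.^ k′) * A k o r)            ∎

    k+l : ℕ
    k+l = k ℕ.+ l

    -- The exponent `half₂ j₂` is already `k` except at `j = o′`, where it is `k - 1`. There `σ j`
    -- is `o`, and `A-row-o` supplies the missing factor `p`.
    A-row : ∀ j {j₂} → Fin.splitAt n j ≡ inj₂ j₂ → ∀ r →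
      + (p ℕ.^ half₂ j₂) * A k+l (σ j) r ≋ + 0 [ p ℕ.^ k ]
    A-row j {suc j₂} eq r = p^*≋0 {k} {k} (A k+l (σ j) r) ℕ.≤-refl
    A-row j {zero}   eq r
      with refl ← Fin.splitAt⁻¹-↑ʳ {n} {n} {j} eq =
      subst (λ t → + (p ℕ.^ k′) * A k+l (σ j) r ≋ + 0 [ p ℕ.^ t ]) (ℕ.+-comm k′ 1) (scale-p^-≋0 k′ 1
        (subst (λ i → A k+l i r ≋ + 0 [ p ℕ.^ 1 ]) (sym (σ-involutive o))
          (≋-trans (≋-lower {m = 1} {k} (ℕ.s≤s ℕ.z≤n) (coh-≤ (mat α o r) (A-coh o r) (ℕ.m≤m+n k l))) (A-row-o r))))

    -- In `dual-column` at level `k + l` the left side vanishes, with p^l coming from `b j` and p^k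
    -- from `A-row`. The right side has the factor p^k times a unit, and cancelling it leaves
    -- precision p^l.
    B-column-σ : ∀ j {j₂} → Fin.splitAt n j ≡ inj₂ j₂ → ∀ r → B k+l (σ r) j ≋ + 0 [ p ℕ.^ l ]
    B-column-σ j {j₂} eq r = sgn-cancel r (cancel-nonmultiple (ν-α k+l)
      (unit-nonmultiple ν-α (proj₁ (proj₂ α-val)) (k′ ℕ.+ l)) l
      (unscale-p^-≋0 k l (≋-trans (≋-reflexive (sym (ℤ.*-assoc (+ (p ℕ.^ k)) (ν-α k+l) sB))) (≋-trans
        (*-cong≋ (≋-sym (at (mult α) (ι (+ (p ℕ.^ k)) ⊗ ν-α) (proj₂ (proj₂ α-val)) k+l)) (≋-refl {sB}))
        (≋-trans (≋-sym (dual-column k+l j r)) (*≋0ʳ (sgn (σ j)) scaled))))))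
      where
      sB : ℤ
      sB = sgn r * B k+l (σ r) j
      exponent : a+b j ≡ l ℕ.+ half₂ j₂
      exponent rewrite eq = ℕ.+-comm (half₂ j₂) l
      scaled : + (p ℕ.^ a+b j) * A k+l (σ j) r ≋ + 0 [ p ℕ.^ k+l ]
      scaled = subst₂ (λ z t → z ≋ + 0 [ p ℕ.^ t ])
        (trans (sym (ℤ.*-assoc (+ (p ℕ.^ l)) (+ (p ℕ.^ half₂ j₂)) (A k+l (σ j) r)))
               (cong (_* A k+l (σ j) r) (trans (sym (p^-+ l (half₂ j₂))) (cong (λ e → + (p ℕ.^ e)) (sym exponent)))))
        (ℕ.+-comm l k)
        (scale-p^-≋0 l k (A-row j eq r))

    B-column : ∀ i j → B (b j) i j ≋ + 0 [ p ℕ.^ b j ]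
    B-column i j with Fin.splitAt n j in eq
    ... | inj₁ _  = ∣⇒≋0 (∣ᵤ⇒∣ (ℕ.1∣ _))
    ... | inj₂ j₂ = ≋-trans (≋-lower {m = l} {l} ℕ.≤-refl (≋-sym (coh-≤ (mat δ i j) (B-coh i j) (ℕ.m≤n+m l k))))
      (subst (λ i → B k+l i j ≋ + 0 [ p ℕ.^ l ]) (σ-involutive i) (B-column-σ j eq (σ i)))

    abstract
      -- U is B diag(p^b)⁻¹, integral by `B-column`; it becomes the matrix of the element of `Γ̃`
      -- that carries a representative to `δ`.
      U : Mat
      U i j = proj₁ (divide-p^ (b j) (mat δ i j) (B-coh i j) (B-column i j))

      U-coh : ∀ i j → Coh (U i j)
      U-coh i j = proj₁ (proj₂ (divide-p^ (b j) (mat δ i j) (B-coh i j) (B-column i j)))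

      B≋p^b*U : ∀ m i j → B m i j ≋ + (p ℕ.^ b j) * U i j m [ p ℕ.^ m ]
      B≋p^b*U m i j = at (mat δ i j) (ι (+ (p ℕ.^ b j)) ⊗ U i j)
        (proj₂ (proj₂ (divide-p^ (b j) (mat δ i j) (B-coh i j) (B-column i j)))) m

    -- Entry `(r , u)` of ᵗB J B is p^(b r + b u) times that of ᵗU J U. Where `J r u` is nonzero,
    -- `u` is `σ r` and the exponent is `l`, which cancels against μ(B) = p^l ν.
    U-symplectic : (tr U · (J · U)) ≈ᴹ (ν *ᴹ J)
    U-symplectic r u = ⊗-cancel-p^ (b r ℕ.+ b u) ((tr U · (J · U)) r u) (ν ⊗ J r u)
      (coh-· (tr U) (J · U) (λ i j → U-coh j i) (coh-· J U coh-J U-coh) r u)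
      (coh-⊗ ν (J r u) (proj₁ ν-unit) (coh-J r u))
      (levelwise (ι P ⊗ (tr U · (J · U)) r u) (ι P ⊗ (ν ⊗ J r u)) λ m →
        ≋-trans (≋-reflexive (trans (cong (P *_) (ᵗAJA-level U r u m)) (distribute m)))
        (≋-trans (sum-cong≋ λ s → *-cong≋ (≋-sym (B≋p^b*U m s r)) (*-congˡ≋ (sgn s) (≋-sym (B≋p^b*U m (σ s) u))))
        (≋-trans (B-symp m r u)
        (≋-trans (*-cong≋ (β≋p^l*ν m) (≋-refl {J r u m}))
        (≋-reflexive (multiplier m))))))
      where
      open ≡-Reasoning
      Pr Pu P : ℤ
      Pr = + (p ℕ.^ b r)
      Pu = + (p ℕ.^ b u)
      P  = + (p ℕ.^ (b r ℕ.+ b u))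
      interleave : ∀ x y z s t → x * y * (z * (s * t)) ≡ x * z * (s * (y * t))
      interleave = solve-∀
      distribute : ∀ m → P * sum (λ s → U s r m * (sgn s * U (σ s) u m)) ≡
                         sum (λ s → Pr * U s r m * (sgn s * (Pu * U (σ s) u m)))
      distribute m = begin
        P * sum (λ s → U s r m * (sgn s * U (σ s) u m))
          ≡⟨ Sum.*-distribˡ-sum P (λ s → U s r m * (sgn s * U (σ s) u m)) ⟩
        sum (λ s → P * (U s r m * (sgn s * U (σ s) u m)))
          ≡⟨ Sum.sum-cong-≗ (λ s → trans (cong (_* (U s r m * (sgn s * U (σ s) u m))) (p^-+ (b r) (b u)))
               (interleave Pr Pu (U s r m) (sgn s) (U (σ s) u m))) ⟩
        sum (λ s → Pr * U s r m * (sgn s * (Pu * U (σ s) u m))) ∎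
      multiplier : ∀ m → + (p ℕ.^ l) * ν m * J r u m ≡ P * (ν m * J r u m)
      multiplier m with u Fin.≟ σ r
      ... | yes refl = trans (ℤ.*-assoc (+ (p ℕ.^ l)) (ν m) (J r (σ r) m))
        (cong (λ e → + (p ℕ.^ e) * (ν m * J r (σ r) m)) (sym (b+bσ r)))
      ... | no u≢σr rewrite J-off r u m u≢σr = both-zero (+ (p ℕ.^ l)) (ν m) P
        where
        both-zero : ∀ x y z → x * y * + 0 ≡ z * (y * + 0)
        both-zero = solve-∀

    -- Both A B and C = diag(p^a) diag(p^b) carry p^(b r) in column `r`. It is cancelled between
    -- p-adic integers, so no precision is lost.
    A·U : ∀ m i r → A m i ⟨·⟩ column r (level m U) ≋ diagℤ a i r [ p ℕ.^ m ]
    A·U m i r = ≋-trans (≋-reflexive (sym (·-level (mat α) U i r m)))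
      (at ((mat α · U) i r) (diag a i r)
        (⊗-cancel-p^ (b r) ((mat α · U) i r) (diag a i r) (coh-· (mat α) U A-coh U-coh i r) (coh-ι (diagℤ a i r))
          (levelwise (ι Pr ⊗ (mat α · U) i r) (ι Pr ⊗ diag a i r) λ m →
            ≋-trans (≋-reflexive (distribute m))
            (≋-trans (sum-cong≋ λ j → *-congˡ≋ (A m i j) (≋-sym (B≋p^b*U m j r)))
            (≋-trans (A·B m i r) (≋-reflexive (diagℤ-+ a b i r)))))) m)
      where
      open ≡-Reasoning
      Pr : ℤ
      Pr = + (p ℕ.^ b r)
      move : ∀ x y z → x * (y * z) ≡ y * (x * z)
      move = solve-∀
      distribute : ∀ m → Pr * (mat α · U) i r m ≡ sum (λ j → A m i j * (Pr * U j r m))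
      distribute m = begin
        Pr * (mat α · U) i r m                       ≡⟨ cong (Pr *_) (·-level (mat α) U i r m) ⟩
        Pr * sum (λ j → A m i j * U j r m)           ≡⟨ Sum.*-distribˡ-sum Pr (λ j → A m i j * U j r m) ⟩
        sum (λ j → Pr * (A m i j * U j r m))         ≡⟨ Sum.sum-cong-≗ (λ j → move Pr (A m i j) (U j r m)) ⟩
        sum (λ j → A m i j * (Pr * U j r m))         ∎

    -- Duality with right side 0 gives ν J x = 0, and ν is a unit.
    U-injective : ∀ x → (∀ i → level l U i ⟨·⟩ x ≋ + 0 [ p ℕ.^ l ]) → ∀ j → x j ≋ + 0 [ p ℕ.^ l ]
    U-injective x Ux≋0 j = subst (λ i → x i ≋ + 0 [ p ℕ.^ l ]) (σ-involutive j)
      (sgn-cancel (σ j) (unit-cancel ν ν-unit l (≋-trans (≋-sym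
        (symplectic-dual l (level l U) (ν l) (symplectic-level U ν U-symplectic l) x (λ _ → + 0) Ux≋0 (σ j)))
        (sum≋0 λ s → *≋0ʳ (U s (σ j) l) (*≋0ʳ (sgn s) ≋-refl)))))

    abstract
      preimage : ∃ λ (y : Fin N → ℤ) → ∀ i → level l U i ⟨·⟩ y ≋ vec δ i l [ p ℕ.^ l ]
      preimage = injective⇒surjective-mod (p ℕ.^ l) {{p^-nonZero l}} (level l U) U-injective (levelᶜ l (vec δ))

    y₀ : Fin N → ℤ
    y₀ = proj₁ preimage

    -- Modulo p^l, diag(p^a) y₀ = A U y₀ = A b = c, where b is `vec δ`.
    p^a*y₀≋c : ∀ j → + (p ℕ.^ a j) * y₀ j ≋ c j [ p ℕ.^ l ]
    p^a*y₀≋c j =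
      ≋-trans (≋-reflexive (sym (diagℤ⟨·⟩ a j y₀)))
      (≋-trans (sum-cong≋ λ r → *-cong≋ (≋-sym (A·U l j r)) (≋-refl {y₀ r}))
      (≋-trans (≋-reflexive (sym (⟨·⟩-assoc (A l j) (level l U) y₀)))
      (≋-trans (sum-cong≋ λ i → *-congˡ≋ (A l j i) (proj₂ preimage i))
               (A·vec l ℕ.≤-refl j))))

    y₀≋c′ : ∀ j → y₀ j ≋ c′ j [ p ℕ.^ (l ℕ.∸ a j) ]
    y₀≋c′ j = unscale-p^ (a j) (l ℕ.∸ a j)
      (subst (λ e → + (p ℕ.^ a j) * y₀ j ≋ c j [ p ℕ.^ e ]) (sym (a+l∸a j)) (p^a*y₀≋c j))

    -- The coefficient of p^(l-aⱼ) in `y₀ j - c′ j`. Modulo p^l only its residue modulo p^aⱼ counts,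
    -- and that residue is the digit `t j`.
    quot : Fin N → ℤ
    quot j = _∣_.quotient (_≋_[_].divides-diff (y₀≋c′ j))

    abstract
      t : Digits
      t j = residue (p ℕ.^ a j) {{p^-nonZero (a j)}} (quot j)

      t≋quot : ∀ j → + toℕ (t j) ≋ quot j [ p ℕ.^ a j ]
      t≋quot j = residue-≋ (p ℕ.^ a j) {{p^-nonZero (a j)}} (quot j)

    w≋y₀ : ∀ j → w t j ≋ y₀ j [ p ℕ.^ l ]
    w≋y₀ j = ≋-trans (+-cong≋ (≋-refl {c′ j}) scaled) (≋-reflexive recombine)
      where
      P : ℤ
      P = + (p ℕ.^ (l ℕ.∸ a j))
      scaled : P * + toℕ (t j) ≋ P * quot j [ p ℕ.^ l ]
      scaled = subst (λ e → P * + toℕ (t j) ≋ P * quot j [ p ℕ.^ e ]) (l∸a+a j)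
        (scale-p^ (l ℕ.∸ a j) (a j) (t≋quot j))
      recombine : c′ j + P * quot j ≡ y₀ j
      recombine = begin
        c′ j + P * quot j        ≡⟨ cong (λ z → c′ j + z) (ℤ.*-comm P (quot j)) ⟩
        c′ j + quot j * P        ≡⟨ cong (λ z → c′ j + z) (_∣_.equality (_≋_[_].divides-diff (y₀≋c′ j))) ⟨
        c′ j + (y₀ j - c′ j)      ≡⟨ restore (c′ j) (y₀ j) ⟩
        y₀ j                      ∎
        where
        open ≡-Reasoning
        restore : ∀ x z → x + (z - x) ≡ z
        restore = solve-∀

    -- What U `w t` misses of `vec δ`. The column of `transition` is multiplied by p^l in the
    -- product with `rep t`, so it can absorb exactly a defect divisible by p^l.
    defect : Col
    defect i = vec δ i ⊕ (⊖ (U ▹ vec (rep t)) i)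

    defect-coh : ∀ i → Coh (defect i)
    defect-coh i = coh-⊕ (vec δ i) (⊖ (U ▹ vec (rep t)) i) (vec-coh i)
      (coh-⊖ ((U ▹ vec (rep t)) i) (coh-▹ U (vec (rep t)) U-coh (λ j → coh-ι (w t j)) i))

    defect≋0 : ∀ i → defect i l ≋ + 0 [ p ℕ.^ l ]
    defect≋0 i = ≋⇒-≋0 (≋-trans (≋-sym (proj₂ preimage i))
      (≋-trans (sum-cong≋ λ j → *-congˡ≋ (U i j l) (≋-sym (w≋y₀ j)))
               (≋-reflexive (sym (▹-level U (vec (rep t)) i l)))))

    abstract
      defect/p^l : ∀ i → ∃ λ u → Coh u × defect i ≈ₚ (ι (+ (p ℕ.^ l)) ⊗ u)
      defect/p^l i = divide-p^ l (defect i) (defect-coh i) (defect≋0 i)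

    transition : Elt
    transition = ⟨ U , (λ i → proj₁ (defect/p^l i)) , ν ⟩

    transition∈Γ̃ : Γ̃ transition
    transition∈Γ̃ = U-coh , (λ i → proj₁ (proj₂ (defect/p^l i))) , proj₁ ν-unit , U-symplectic ,
      (ν , ν-unit , levelwise ν (ι (+ 1) ⊗ ν) λ m → ≋-reflexive (sym (ℤ.*-identityˡ (ν m))))

    transition-rep≈δ : (transition ∘̃ rep t) ≈ᴱ δ
    transition-rep≈δ =
      (λ i j → levelwise ((U · diag b) i j) (mat δ i j) λ m →
        ≋-trans (≋-reflexive (trans (·-level U (diag b) i j m) (⟨·⟩diagℤ b (level m U i) j)))
                (≋-sym (B≋p^b*U m i j))) ,
      (λ i → levelwise (vec (transition ∘̃ rep t) i) (vec δ i) λ m →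
        ≋-trans (+-cong≋ (≋-refl {(U ▹ vec (rep t)) i m})
                         (≋-sym (at (defect i) (ι (+ (p ℕ.^ l)) ⊗ proj₁ (defect/p^l i)) (proj₂ (proj₂ (defect/p^l i))) m)))
                (≋-reflexive (restore ((U ▹ vec (rep t)) i m) (vec δ i m)))) ,
      levelwise (ν ⊗ ι (+ (p ℕ.^ l))) (mult δ) λ m →
        ≋-trans (≋-reflexive (ℤ.*-comm (ν m) (+ (p ℕ.^ l)))) (≋-sym (β≋p^l*ν m))
      where
      restore : ∀ x z → x + (z + - x) ≡ z
      restore = solve-∀

  open ΠFin-Enumeration (enumerate-ΠFin (λ j → p ℕ.^ a j)) public

  -- The enumeration returns digits up to pointwise equality only. The digits enter the column
  -- alone, so the matrix and multiplier parts carry over unchanged.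
  SameCoset-cong : ∀ {x δ} s t → (∀ j → s j ≡ t j) → (x ∘̃ rep s) ≈ᴱ δ → (x ∘̃ rep t) ≈ᴱ δ
  SameCoset-cong {x} {δ} s t s≗t (M , V , K) = M ,
    (λ i → levelwise (vec (x ∘̃ rep t) i) (vec δ i) λ m → ≋-trans
      (≋-reflexive (cong (λ z → z + + (p ℕ.^ l) * vec x i m) (begin
        (mat x ▹ vec (rep t)) i m                 ≡⟨ ▹-level (mat x) (vec (rep t)) i m ⟩
        level m (mat x) i ⟨·⟩ w t                 ≡⟨ Sum.sum-cong-≗ (λ j → cong (λ d → mat x i j m * (c′ j + + (p ℕ.^ (l ℕ.∸ a j)) * + toℕ d)) (sym (s≗t j))) ⟩
        level m (mat x) i ⟨·⟩ w s                 ≡⟨ ▹-level (mat x) (vec (rep s)) i m ⟨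
        (mat x ▹ vec (rep s)) i m                 ∎)))
      (at (vec (x ∘̃ rep s) i) (vec δ i) (V i) m)) ,
    K
    where open ≡-Reasoning

  count : CoeffTT k l γ size
  count = rep ∘ enum , rep∈Mset ∘ enum ,
    (λ i j same → injective (rep-injective (enum i) (enum j) same)) ,
    covered
    where
    covered : ∀ δ → Mset k l γ δ → ∃ λ i → SameCoset (rep (enum i)) δ
    covered δ (δ∈ , α , α∈ , αδ≈γ) = i , transition , transition∈Γ̃ ,
      SameCoset-cong {transition} {δ} t (enum i) (λ j → sym (proj₂ (surjective t) j)) transition-rep≈δ
      where
      open RightDivisor δ δ∈ α α∈ αδ≈γ
      i = proj₁ (surjective t)

  -- The choice of all digits equal to 0 has an index in the enumeration.
  size≢0 : size ≢ 0
  size≢0 size≡0 = Fin.¬Fin0 (subst Fin size≡0 (proj₁ (surjective λ j → residue (p ℕ.^ a j) {{p^-nonZero (a j)}} (+ 0))))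

theorem4p6 : (p : ℕ) → Prime p → (n : ℕ) → 1 ≤ n → (k l : ℕ) → 1 ≤ k → k < l →
    ∃ λ γ → ∃ λ j → Hecke.Δ̃ p n j γ ×
    ∃ λ m → ∃ λ m′ → Hecke.CoeffTT p n k l γ m × Hecke.CoeffTT p n l k γ m′ × m ≢ m′
theorem4p6 p p-prime (suc n′) _ (suc k′) l _ k<l =
  γ , suc k′ ℕ.+ l , γ∈Δ̃ , size , 0 , count ,
  -- The count 0 is realised by the empty family of representatives, which covers every `δ` because
  -- there is none.
  ((λ ()) , (λ ()) , (λ ()) , λ δ δ∈Mset → contradiction δ∈Mset (Mset-l-k-empty δ)) ,
  size≢0
  where
  open Counterexample p p-prime n′ k′ l k<l
  open Representatives p p-prime n′ k′ l k<l
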